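{- Suppose that each of the $n$ devices has a unique identifier in $[N]$, and that the size $N$ of the ID space and an estimate $\tilde{n}$ of the number of devices $n$ with $\tilde{n}/2 < n \leq \tilde{n}$ are both known to all devices. Then there is a deterministic leader election algorithm in the $\mathsf{No}\text{ - }\mathsf{CD}$ model with time complexity $O\left(n \log \frac{N}{n}\right)$ and energy complexity $O\left(\log \frac{N}{n}\right)$.
   Context: Model: $n$ devices are connected to a multiple-access channel. Communication proceeds in synchronous rounds with a common time zero; in each round each device either transmits a message, listens to the channel, or stays idle. In the $\mathsf{No}\text{ - }\mathsf{CD}$ model, transmitters receive no feedback, and a listener receives the message $m$ if exactly one device transmits in that round, and otherwise (zero or at least two transmitters) receives silence. Leader election: exactly one device must identify itself as the leader and all others as non-leaders; the protocol ends when the leader sends a message while every non-leader listens, so all devices terminate in the same round. Time complexity is the number of rounds (worst case); the energy cost of a device is its number of non-idle (transmitting or listening) rounds, and the energy complexity is the maximum energy cost over all devices (worst case).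
   Formalization: The factor log(N/n) is read as 1 + ⌊log₂⌊N/n⌋⌋, since for N = n (or N close to n) the literal bound is 0 or tends to 0, while any leader election needs at least one round and one unit of energy. -}

module Defs where

open import Data.Nat using (ℕ; zero; suc; _+_; _*_; _≤_; _<_)
open import Data.Nat.DivMod using (_/_)
open import Data.Nat.Logarithm using (⌊log₂_⌋)
open import Data.Bool using (Bool; true; false)
open import Data.Fin using (Fin)
open import Data.List using (List; []; _∷_; mapMaybe; length; filter)
open import Data.List using (allFin) public
open import Data.Maybe using (Maybe; just; nothing)
open import Data.Product using (Σ; ∃; _×_; _,_)
open import Relation.Binary.PropositionalEquality using (_≡_; _≢_)
open import Function.Definitions using (Injective)

-- Messages are natural numbers (any finite message can be encoded).
Message : Set
Message = ℕ

data Action : Set where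
  idle     : Action
  listen   : Action
  transmit : Message → Action

-- What a device observes in one round (No-CD model):
-- `just m` if it listened and exactly one device transmitted m;
-- `nothing` otherwise (silence / collision, or it did not listen;
-- transmitters get no feedback).
Feedback : Set
Feedback = Maybe Message

-- Local history of a device: the feedback of all past rounds,
-- most recent first.
History : Set
History = List Feedback

-- Role output: true = leader, false = non-leader.
Role : Set
Role = Bool

-- A deterministic protocol for an ID space [N] (identified with Fin N).
-- The parameters N and ñ are known to the devices: a protocol is chosen
-- per (N, ñ).  A device's action and its termination decision depend only
-- on its own ID and its local history.
record Protocol (N : ℕ) : Set where
  field
    act    : Fin N → History → Action
    -- `decide i h = just r` : after history h the device has terminated
    -- with role r; `nothing` : still running.
    decide : Fin N → History → Maybe Role
open Protocol public

isTransmit : Action → Maybe Message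
isTransmit (transmit m) = just m
isTransmit idle         = nothing
isTransmit listen       = nothing

isIdle : Action → Bool
isIdle idle = true
isIdle _    = false

channel : List Message → Maybe Message
channel (m ∷ []) = just m
channel _        = nothing

module Execution {N n : ℕ} (P : Protocol N) (ids : Fin n → Fin N) where

  history : ℕ → Fin n → History
  -- action of device i in round t (rounds numbered 0,1,2,…)
  action  : ℕ → Fin n → Action
  action t i = act P (ids i) (history t i)

  transmissions : ℕ → List Message
  transmissions t = mapMaybe (λ j → isTransmit (action t j)) (allFin n)

  feedback : ℕ → Fin n → Feedback
  feedback t i with action t i
  ... | listen = channel (transmissions t)
  ... | _      = nothing

  history zero    i = []
  history (suc t) i = feedback t i ∷ history t i

  status : ℕ → Fin n → Maybe Role
  status t i = decide P (ids i) (history t i)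

  energy : ℕ → Fin n → ℕ
  energy zero    i = 0
  energy (suc t) i with isIdle (action t i)
  ... | true  = energy t i
  ... | false = suc (energy t i)

  ElectsLeaderAt : ℕ → Set
  ElectsLeaderAt zero    = Data.Empty.⊥ where import Data.Empty
  ElectsLeaderAt (suc t) =
    (∀ s i → s ≤ t → status s i ≡ nothing) ×
    Σ (Fin n) λ ℓ →
      (status (suc t) ℓ ≡ just true) ×
      (∀ i → i ≢ ℓ → status (suc t) i ≡ just false) ×
      (∃ λ m → action t ℓ ≡ transmit m) ×
      (∀ i → i ≢ ℓ → action t i ≡ listen)

-- log(N/n), with the usual convention that it is at least 1:
-- logRatio N n = 1 + ⌊log₂ ⌊N/n⌋⌋  (n ≥ 1).
logRatio : ℕ → ℕ → ℕ
logRatio N zero    = 1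
logRatio N (suc k) = suc ⌊log₂ (N / suc k)⌋

SolvesLE : (c N ñ : ℕ) → Protocol N → Set
SolvesLE c N ñ P =
  ∀ (n : ℕ) → ñ < 2 * n → n ≤ ñ →
  (ids : Fin n → Fin N) → Injective _≡_ _≡_ ids →
  Σ ℕ λ T →
    Execution.ElectsLeaderAt P ids T ×
    T ≤ c * (n * logRatio N n) ×
    (∀ i → Execution.energy P ids T i ≤ c * logRatio N n)

{-# OPTIONS --safe #-}

-- Hash the IDs into M = Λ ñ cells and let a phase visit the cells in order.  The devices seen so far
-- form a first-in-first-out queue: a device that is alone in its cell contributes c = 4 Λ cells of duty,
-- and each cell uses up one.  The device on duty tells a newcomer how much duty is queued, so the newcomer
-- can sleep until its own turn; hence a phase costs O(M) rounds and O(1) energy.  If more than M / c = ñ / 4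
-- devices are alone in their cells, the queue is not exhausted when the phase ends, and the device then on
-- duty eliminates all others.  Otherwise nothing is lost, and the next phase uses another hash function.
--
-- For a random hash function, adding a device to a set of size at most ñ hits an occupied cell with
-- probability at most 1 / Λ, so the expectation of Λ ^ (number of hits) is at most 2 ^ ñ.  Hence some hash
-- function is bad for at most a fraction 2 ^ - ñ of any family of such sets.  With B = 2 ^ logRatio N ñ ≥ N / ñ
-- there are at most (4 B) ^ ñ sets, so 3 + logRatio N ñ phases leave none without a good hash function.
module Submission where

open import Defs
open import Data.Bool using (Bool; true; false; if_then_else_; T)
open import Data.Empty using (⊥; ⊥-elim)
open import Data.Fin using (Fin; zero; suc)
import Data.Fin as Fin
open import Data.Fin.Properties using (any?) renaming (suc-injective to fsuc-injective)
open import Data.List using (List; []; _∷_; _++_; length; mapMaybe; tabulate; catMaybes; drop)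
open import Data.List.Properties using (length-++; map-tabulate; mapMaybe-cong)
open import Data.List.Relation.Unary.Any as Any using (Any; here; there)
open import Data.Maybe using (Maybe; just; nothing; is-just)
open import Data.Nat
open import Data.Nat.DivMod using (_/_; _%_; m≡m%n+[m/n]*n; m%n<n; /-monoʳ-≤)
open import Data.Nat.Logarithm using (⌊log₂_⌋; ⌊log₂⌋-mono-≤; ⌊log₂[2^n]⌋≡n)
open import Data.Nat.Properties
open import Data.Nat.Tactic.RingSolver using (solve-∀)
open import Data.Product using (Σ; ∃; _×_; _,_; proj₁; proj₂; map₂)
open import Data.Sum using (_⊎_; inj₁; inj₂; fromInj₂)
open import Data.Vec as Vec using (Vec; []; _∷_; lookup)
open import Function using (_∘_; id)
open import Function.Definitions using (Injective)
open import Relation.Binary.PropositionalEquality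
open import Relation.Nullary using (¬_; Dec; yes; no; does; contradiction)

open import Algebra.Properties.Semiring.Sum +-*-semiring
  using (sum; sum-cong-≗; ∑-distrib-+; ∑-comm; *-distribˡ-sum; *-distribʳ-sum)

-- Finite sums and averaging.

sum-mono : ∀ {n} {f g : Fin n → ℕ} → (∀ i → f i ≤ g i) → sum f ≤ sum g
sum-mono {zero}  f≤g = z≤n
sum-mono {suc n} f≤g = +-mono-≤ (f≤g zero) (sum-mono (f≤g ∘ suc))

sum-const : ∀ n k → sum {n} (λ _ → k) ≡ n * k
sum-const zero    k = refl
sum-const (suc n) k = cong (k +_) (sum-const n k)

δ : ∀ {m} → Fin m → Fin m → ℕ
δ x y = if does (x Fin.≟ y) then 1 else 0

sum-δ : ∀ {m} (x : Fin m) (f : Fin m → ℕ) → sum (λ y → δ x y * f y) ≡ f x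
sum-δ {suc m} zero    f = trans (cong₂ _+_ (*-identityˡ _) (trans (sum-const m 0) (*-zeroʳ m))) (+-identityʳ _)
sum-δ {suc m} (suc x) f = sum-δ x (f ∘ suc)

≤-average : ∀ {n} .{{_ : NonZero n}} (f : Fin n → ℕ) b → sum f ≤ n * b → ∃ λ x → f x ≤ b
≤-average {n} f b Σf≤nb with any? (λ x → f x ≤? b)
... | yes found = found
... | no  none  = contradiction Σf≤nb (<⇒≱ (begin-strict
  n * b               <⟨ *-monoʳ-< n (n<1+n b) ⟩
  n * suc b           ≡⟨ sum-const n (suc b) ⟨
  sum {n} (λ _ → suc b) ≤⟨ sum-mono (λ x → ≰⇒> (λ fx≤b → none (x , fx≤b))) ⟩
  sum f               ∎))
  where open ≤-Reasoning

-- Sums over all subsets of the ID space.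

-- A subset of [N] is represented by its characteristic vector.
sumₛ : ∀ {N} → (Vec Bool N → ℕ) → ℕ
sumₛ {zero}  F = F []
sumₛ {suc N} F = sumₛ (F ∘ (false ∷_)) + sumₛ (F ∘ (true ∷_))

sumₛ-mono : ∀ {N} {F G : Vec Bool N → ℕ} → (∀ S → F S ≤ G S) → sumₛ F ≤ sumₛ G
sumₛ-mono {zero}  F≤G = F≤G []
sumₛ-mono {suc N} F≤G = +-mono-≤ (sumₛ-mono (F≤G ∘ (false ∷_))) (sumₛ-mono (F≤G ∘ (true ∷_)))

sumₛ-cong : ∀ {N} {F G : Vec Bool N → ℕ} → (∀ S → F S ≡ G S) → sumₛ F ≡ sumₛ G
sumₛ-cong F≡G = ≤-antisym (sumₛ-mono (≤-reflexive ∘ F≡G)) (sumₛ-mono (≤-reflexive ∘ sym ∘ F≡G))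

sumₛ-+ : ∀ {N} (F G : Vec Bool N → ℕ) → sumₛ (λ S → F S + G S) ≡ sumₛ F + sumₛ G
sumₛ-+ {zero}  F G = refl
sumₛ-+ {suc N} F G = trans
  (cong₂ _+_ (sumₛ-+ (F ∘ (false ∷_)) (G ∘ (false ∷_))) (sumₛ-+ (F ∘ (true ∷_)) (G ∘ (true ∷_))))
  (+-interchange (sumₛ (F ∘ (false ∷_))) _ _ _)
  where
  +-interchange : ∀ a b c d → (a + b) + (c + d) ≡ (a + c) + (b + d)
  +-interchange = solve-∀

sumₛ-* : ∀ {N} k (F : Vec Bool N → ℕ) → sumₛ (λ S → k * F S) ≡ k * sumₛ F
sumₛ-* {zero}  k F = refl
sumₛ-* {suc N} k F = trans (cong₂ _+_ (sumₛ-* k (F ∘ (false ∷_))) (sumₛ-* k (F ∘ (true ∷_)))) (sym (*-distribˡ-+ k (sumₛ (F ∘ (false ∷_))) _))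

sumₛ-sum : ∀ {N m} (F : Fin m → Vec Bool N → ℕ) → sumₛ (λ S → sum (λ x → F x S)) ≡ sum (λ x → sumₛ (F x))
sumₛ-sum {zero}  F = refl
sumₛ-sum {suc N} F = trans (cong₂ _+_ (sumₛ-sum (λ x → F x ∘ (false ∷_))) (sumₛ-sum (λ x → F x ∘ (true ∷_))))
  (sym (∑-distrib-+ (λ x → sumₛ (F x ∘ (false ∷_))) (λ x → sumₛ (F x ∘ (true ∷_)))))

≤-sumₛ : ∀ {N} (F : Vec Bool N → ℕ) S → F S ≤ sumₛ F
≤-sumₛ F []          = ≤-refl
≤-sumₛ F (false ∷ S) = ≤-trans (≤-sumₛ (F ∘ (false ∷_)) S) (m≤m+n _ _)
≤-sumₛ F (true ∷ S)  = ≤-trans (≤-sumₛ (F ∘ (true ∷_)) S) (m≤n+m _ _)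

-- Occupancy of the cells under a hash function.

size : ∀ {N} → Vec Bool N → ℕ
size []          = 0
size (false ∷ S) = size S
size (true  ∷ S) = suc (size S)

occupancy : ∀ {M N} → Vec (Fin M) N → Vec Bool N → Fin M → ℕ
occupancy []      []          q = 0
occupancy (x ∷ v) (false ∷ S) q = occupancy v S q
occupancy (x ∷ v) (true  ∷ S) q = δ x q + occupancy v S q

-- Counts the hits of occupied cells when the IDs in `S` enter their cells one by one, the last ID
-- first. In this order the hash value of the head can be chosen after those of the tail.
excess : ∀ {M N} → Vec (Fin M) N → Vec Bool N → ℕ
excess []      []          = 0
excess (x ∷ v) (false ∷ S) = excess v S
excess (x ∷ v) (true  ∷ S) = (1 ⊓ occupancy v S x) + excess v S

sum-occupancy : ∀ {M N} (v : Vec (Fin M) N) S → sum (occupancy v S) ≡ size S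
sum-occupancy {M} []      []          = trans (sum-const M 0) (*-zeroʳ M)
sum-occupancy     (x ∷ v) (false ∷ S) = sum-occupancy v S
sum-occupancy     (x ∷ v) (true  ∷ S) = begin
  sum (λ q → δ x q + occupancy v S q)     ≡⟨ ∑-distrib-+ (δ x) (occupancy v S) ⟩
  sum (δ x) + sum (occupancy v S)         ≡⟨ cong₂ _+_ (trans (sum-cong-≗ (λ q → sym (*-identityʳ (δ x q)))) (sum-δ x (λ _ → 1))) (sum-occupancy v S) ⟩
  suc (size S)                            ∎
  where open ≡-Reasoning

-- A new ID raises `occupancy ∸ 1` only in its own cell, and only if that cell was occupied; in that
-- case `excess` grows too.
sum-excess : ∀ {M N} (v : Vec (Fin M) N) S → sum (λ q → occupancy v S q ∸ 1) ≤ excess v S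
sum-excess {M} []      []          = ≤-reflexive (trans (sum-const M 0) (*-zeroʳ M))
sum-excess     (x ∷ v) (false ∷ S) = sum-excess v S
sum-excess     (x ∷ v) (true  ∷ S) = begin
  sum (λ q → (δ x q + o q) ∸ 1)                      ≤⟨ sum-mono (λ q → step (does (x Fin.≟ q)) (o q)) ⟩
  sum (λ q → δ x q * (1 ⊓ o q) + (o q ∸ 1))          ≡⟨ ∑-distrib-+ (λ q → δ x q * (1 ⊓ o q)) (λ q → o q ∸ 1) ⟩
  sum (λ q → δ x q * (1 ⊓ o q)) + sum (λ q → o q ∸ 1) ≤⟨ +-mono-≤ (≤-reflexive (sum-δ x (λ q → 1 ⊓ o q))) (sum-excess v S) ⟩
  (1 ⊓ o x) + excess v S                             ∎
  where
  open ≤-Reasoning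
  o = occupancy v S
  step : ∀ b k → ((if b then 1 else 0) + k) ∸ 1 ≤ (if b then 1 else 0) * (1 ⊓ k) + (k ∸ 1)
  step false k       = ≤-refl
  step true  zero    = ≤-refl
  step true  (suc k) = ≤-refl

single : ℕ → ℕ
single 1 = 1
single _ = 0

-- A cell with `k ≥ 2` devices satisfies `k ≤ 2 * (k ∸ 1)`, so the number of devices that share a
-- cell is at most twice the excess.
size≤single+excess : ∀ {M N} (v : Vec (Fin M) N) S → size S ≤ sum (single ∘ occupancy v S) + 2 * excess v S
size≤single+excess v S = begin
  size S                                             ≡⟨ sum-occupancy v S ⟨
  sum o                                              ≤⟨ sum-mono (step ∘ o) ⟩
  sum (λ q → single (o q) + 2 * (o q ∸ 1))           ≡⟨ ∑-distrib-+ (single ∘ o) (λ q → 2 * (o q ∸ 1)) ⟩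
  sum (single ∘ o) + sum (λ q → 2 * (o q ∸ 1))       ≡⟨ cong (sum (single ∘ o) +_) (*-distribˡ-sum 2 (λ q → o q ∸ 1)) ⟨
  sum (single ∘ o) + 2 * sum (λ q → o q ∸ 1)         ≤⟨ +-monoʳ-≤ (sum (single ∘ o)) (*-monoʳ-≤ 2 (sum-excess v S)) ⟩
  sum (single ∘ o) + 2 * excess v S                  ∎
  where
  open ≤-Reasoning
  o = occupancy v S
  step : ∀ k → k ≤ single k + 2 * (k ∸ 1)
  step 0             = z≤n
  step 1             = ≤-refl
  step (suc (suc k)) = s≤s (≤-trans (≤-reflexive (+-comm 1 k)) (+-monoʳ-≤ k (s≤s z≤n)))

-- A hash function of small average excess.

module Hash (Λ ñ : ℕ) .{{_ : NonZero Λ}} .{{_ : NonZero ñ}} where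

  M : ℕ
  M = Λ * ñ

  private instance
    M≢0 : NonZero M
    M≢0 = m*n≢0 Λ ñ

  -- The bound is linear in the occupancy `k`, so its sum over all cells depends only on the size of
  -- the set.
  Λ^-bound : ∀ k e → Λ ^ ((1 ⊓ k) + e) ≤ (1 + Λ * k) * Λ ^ e
  Λ^-bound zero    e = m≤m+n _ _
  Λ^-bound (suc k) e = *-monoˡ-≤ (Λ ^ e) (m≤n⇒m≤1+n (m≤m*n Λ (suc k)))

  -- As `Λ * size S ≤ M`, the sum of `1 + Λ * occupancy` over the `M` cells is at most `2 * M`: a
  -- random cell for one more ID at most doubles the expected weight.
  average-cell : ∀ {N} (v : Vec (Fin M) N) S w → size S ≤ ñ →
    sum (λ x → w * Λ ^ ((1 ⊓ occupancy v S x) + excess v S)) ≤ M * (2 * (w * Λ ^ excess v S))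
  average-cell v S w |S|≤ñ = begin
    sum (λ x → w * Λ ^ ((1 ⊓ o x) + e))     ≤⟨ sum-mono (λ x → *-monoʳ-≤ w (Λ^-bound (o x) e)) ⟩
    sum (λ x → w * ((1 + Λ * o x) * Λ ^ e)) ≡⟨ sum-cong-≗ (λ x → swap w (1 + Λ * o x) (Λ ^ e)) ⟩
    sum (λ x → (1 + Λ * o x) * K)           ≡⟨ *-distribʳ-sum K (λ x → 1 + Λ * o x) ⟨
    sum (λ x → 1 + Λ * o x) * K             ≡⟨ cong (_* K) (∑-distrib-+ (λ _ → 1) (λ x → Λ * o x)) ⟩
    (sum {M} (λ _ → 1) + sum (λ x → Λ * o x)) * K ≡⟨ cong (_* K) (cong₂ _+_ (trans (sum-const M 1) (*-identityʳ M)) (trans (sym (*-distribˡ-sum Λ o)) (cong (Λ *_) (sum-occupancy v S)))) ⟩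
    (M + Λ * size S) * K                    ≤⟨ *-monoˡ-≤ K (+-monoʳ-≤ M (*-monoʳ-≤ Λ |S|≤ñ)) ⟩
    (M + M) * K                             ≡⟨ double M K ⟩
    M * (2 * K)                             ∎
    where
    open ≤-Reasoning
    o = occupancy v S
    e = excess v S
    K = w * Λ ^ e
    swap : ∀ a b c → a * (b * c) ≡ b * (a * c)
    swap = solve-∀
    double : ∀ a b → (a + a) * b ≡ a * (2 * b)
    double = solve-∀

  -- A greedy choice of hash values: the weight of the sets containing the first ID is doubled
  -- before the values of the other IDs are chosen, which pays for averaging over the cell of the first.
  hash-exists : ∀ {N} (W : Vec Bool N → ℕ) → (∀ S → ñ < size S → W S ≡ 0) →
    ∃ λ v → sumₛ (λ S → W S * Λ ^ excess {M} v S) ≤ sumₛ (λ S → W S * 2 ^ size S)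
  hash-exists {zero}  W supp = [] , ≤-refl
  hash-exists {suc N} W supp = x ∷ v , bound
    where
    W₀ W₁ : Vec Bool N → ℕ
    W₀ S = W (false ∷ S)
    W₁ S = W (true ∷ S)
    rest = hash-exists (λ S → W₀ S + 2 * W₁ S) (λ S ñ<S → cong₂ (λ a b → a + 2 * b) (supp (false ∷ S) ñ<S) (supp (true ∷ S) (m≤n⇒m≤1+n ñ<S)))
    v = proj₁ rest
    E : Vec Bool N → ℕ
    E S = Λ ^ excess v S
    F : Fin M → Vec Bool N → ℕ
    F y S = W₁ S * Λ ^ ((1 ⊓ occupancy v S y) + excess v S)
    G₀ G₁ : Vec Bool N → ℕ
    G₀ S = W₀ S * E S
    G₁ S = W₁ S * E S
    B = sumₛ G₁
    -- Larger sets have weight zero, so averaging over the cells is needed only for sets of size at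
    -- most `ñ`.
    pointwise : ∀ S → sum (λ y → F y S) ≤ M * (2 * (W₁ S * E S))
    pointwise S with size S ≤? ñ
    ... | yes |S|≤ñ = average-cell v S (W₁ S) |S|≤ñ
    ... | no  |S|≰ñ = ≤-trans (≤-reflexive (trans (sum-cong-≗ (λ y → cong (_* Λ ^ ((1 ⊓ occupancy v S y) + excess v S)) (supp (true ∷ S) (m≤n⇒m≤1+n (≰⇒> |S|≰ñ)))))
                                        (trans (sum-const M 0) (*-zeroʳ M)))) z≤n
    open ≤-Reasoning
    choice : ∃ λ y → sumₛ (F y) ≤ 2 * B
    choice = ≤-average (λ y → sumₛ (F y)) (2 * B) (begin
      sum (λ y → sumₛ (F y))                 ≡⟨ sumₛ-sum F ⟨
      sumₛ (λ S → sum (λ y → F y S))         ≤⟨ sumₛ-mono pointwise ⟩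
      sumₛ (λ S → M * (2 * G₁ S))    ≡⟨ trans (sumₛ-* M (λ S → 2 * G₁ S)) (cong (M *_) (sumₛ-* 2 G₁)) ⟩
      M * (2 * B)                            ∎)
    x = proj₁ choice
    expand : ∀ a b c → (a + 2 * b) * c ≡ a * c + 2 * (b * c)
    expand = solve-∀
    expand′ : ∀ a b c → (a + 2 * b) * c ≡ a * c + b * (2 * c)
    expand′ = solve-∀
    bound : sumₛ G₀ + sumₛ (F x) ≤ sumₛ (λ S → W₀ S * 2 ^ size S) + sumₛ (λ S → W₁ S * 2 ^ suc (size S))
    bound = begin
      sumₛ G₀ + sumₛ (F x)                  ≤⟨ +-monoʳ-≤ _ (proj₂ choice) ⟩
      sumₛ G₀ + 2 * B                       ≡⟨ cong (sumₛ G₀ +_) (sumₛ-* 2 G₁) ⟨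
      sumₛ G₀ + sumₛ (λ S → 2 * G₁ S)           ≡⟨ sumₛ-+ G₀ (λ S → 2 * G₁ S) ⟨
      sumₛ (λ S → G₀ S + 2 * G₁ S)                          ≡⟨ sumₛ-cong (λ S → expand (W₀ S) (W₁ S) (E S)) ⟨
      sumₛ (λ S → (W₀ S + 2 * W₁ S) * E S)                  ≤⟨ proj₂ rest ⟩
      sumₛ (λ S → (W₀ S + 2 * W₁ S) * 2 ^ size S)           ≡⟨ sumₛ-cong (λ S → expand′ (W₀ S) (W₁ S) (2 ^ size S)) ⟩
      sumₛ (λ S → W₀ S * 2 ^ size S + W₁ S * 2 ^ suc (size S)) ≡⟨ sumₛ-+ (λ S → W₀ S * 2 ^ size S) (λ S → W₁ S * 2 ^ suc (size S)) ⟩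
      sumₛ (λ S → W₀ S * 2 ^ size S) + sumₛ (λ S → W₁ S * 2 ^ suc (size S)) ∎

-- Counting the small subsets.

_unless_ : ∀ {a} {A : Set a} → ℕ → Dec A → ℕ
w unless yes _ = 0
w unless no  _ = w

absent : ∀ {N} → Vec Bool N → ℕ
absent []          = 0
absent (false ∷ S) = suc (absent S)
absent (true  ∷ S) = absent S

absent+size : ∀ {N} (S : Vec Bool N) → absent S + size S ≡ N
absent+size []          = refl
absent+size (false ∷ S) = cong suc (absent+size S)
absent+size (true  ∷ S) = trans (+-suc (absent S) (size S)) (cong suc (absent+size S))

-- The binomial theorem: each ID contributes a factor `B` if absent and 1 if present.
sumₛ-absent : ∀ N B → sumₛ {N} (λ S → B ^ absent S) ≡ (1 + B) ^ N
sumₛ-absent zero    B = refl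
sumₛ-absent (suc N) B = begin
  sumₛ {N} (λ S → B * B ^ absent S) + sumₛ {N} (λ S → B ^ absent S)
    ≡⟨ cong₂ _+_ (trans (sumₛ-* {N} B (λ S → B ^ absent S)) (cong (B *_) (sumₛ-absent N B))) (sumₛ-absent N B) ⟩
  B * (1 + B) ^ N + (1 + B) ^ N   ≡⟨ +-comm (B * (1 + B) ^ N) _ ⟩
  (1 + B) * (1 + B) ^ N           ∎
  where open ≡-Reasoning

^-distribʳ-* : ∀ k m n → (m * n) ^ k ≡ m ^ k * n ^ k
^-distribʳ-* zero    m n = refl
^-distribʳ-* (suc k) m n = trans (cong (m * n *_) (^-distribʳ-* k m n)) (*-interchange m n (m ^ k) (n ^ k))
  where
  *-interchange : ∀ a b c d → (a * b) * (c * d) ≡ (a * c) * (b * d)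
  *-interchange = solve-∀

-- Bernoulli's inequality (1 - 1/(1+B))^j ≥ 1 - j/B with denominators cleared.
bernoulli : ∀ B j r → B ≡ j + r → (1 + B) ^ j * r ≤ B ^ j * B
bernoulli B zero    r refl = ≤-refl
bernoulli B (suc j) r B≡ = begin
  (1 + B) * (1 + B) ^ j * r         ≡⟨ rearrange (1 + B) ((1 + B) ^ j) r ⟩
  (1 + B) ^ j * (r + B * r)         ≤⟨ *-monoʳ-≤ ((1 + B) ^ j) (+-monoˡ-≤ (B * r) (subst (r ≤_) (sym B≡) (m≤n+m r (suc j)))) ⟩
  (1 + B) ^ j * (B + B * r)         ≡⟨ rearrange′ ((1 + B) ^ j) B r ⟩
  B * ((1 + B) ^ j * suc r)         ≤⟨ *-monoʳ-≤ B (bernoulli B j (suc r) (trans B≡ (sym (+-suc j r)))) ⟩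
  B * (B ^ j * B)                   ≡⟨ *-assoc B (B ^ j) B ⟨
  B * B ^ j * B                     ∎
  where
  open ≤-Reasoning
  rearrange : ∀ a b r → a * b * r ≡ b * (a * r)
  rearrange = solve-∀
  rearrange′ : ∀ a b r → a * (b + b * r) ≡ b * (a * (1 + r))
  rearrange′ = solve-∀

-- For `B = 2 * k`, Bernoulli's inequality with `j = r = k` gives `(1 + 1/B) ^ k ≤ 2`; squaring
-- yields 4.
[1+1/B]^B≤4 : ∀ k .{{_ : NonZero k}} → (1 + 2 * k) ^ (2 * k) ≤ 4 * (2 * k) ^ (2 * k)
[1+1/B]^B≤4 k = begin
  (1 + 2 * k) ^ (2 * k)             ≡⟨ halve (1 + 2 * k) ⟩
  (1 + 2 * k) ^ k * (1 + 2 * k) ^ k ≤⟨ *-mono-≤ root root ⟩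
  (2 * X) * (2 * X)                 ≡⟨ square X ⟩
  4 * (X * X)                       ≡⟨ cong (4 *_) (halve (2 * k)) ⟨
  4 * (2 * k) ^ (2 * k)             ∎
  where
  open ≤-Reasoning
  X = (2 * k) ^ k
  halve : ∀ a → a ^ (2 * k) ≡ a ^ k * a ^ k
  halve a = trans (cong (λ j → a ^ (k + j)) (+-identityʳ k)) (^-distribˡ-+-* a k k)
  square : ∀ x → (2 * x) * (2 * x) ≡ 4 * (x * x)
  square = solve-∀
  assoc : ∀ x k → x * (2 * k) ≡ (2 * x) * k
  assoc = solve-∀
  root : (1 + 2 * k) ^ k ≤ 2 * X
  root = *-cancelʳ-≤ _ _ k (≤-trans (bernoulli (2 * k) k k (cong (k +_) (+-identityʳ k))) (≤-reflexive (assoc X k)))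

-- A short list of hash functions that serves every small set.

module Hashes (κ ñ : ℕ) (16≤κ : 16 ≤ κ) .{{_ : NonZero ñ}} where

  Λ : ℕ
  Λ = 2 ^ κ

  instance
    Λ≢0 : NonZero Λ
    Λ≢0 = m^n≢0 2 κ

  open Hash Λ ñ public

  -- At most 2 * excess devices share their cell with another one, hence fewer than ñ / 4.
  Good : ∀ {N} → Vec Bool N → Vec (Fin M) N → Set
  Good S v = 8 * excess v S < ñ

  -- With `κ ≥ 16`, an excess of at least `ñ / 8` gives weight at least `4 ^ ñ`. One factor `2 ^ ñ`
  -- offsets the `2 ^ size S` of `hash-exists`, the other is the gain of one hash function.
  ^-bad : ∀ e → ñ ≤ 8 * e → 2 ^ ñ * 2 ^ ñ ≤ Λ ^ e
  ^-bad e ñ≤8e = begin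
    2 ^ ñ * 2 ^ ñ     ≡⟨ ^-distribˡ-+-* 2 ñ ñ ⟨
    2 ^ (ñ + ñ)       ≤⟨ ^-monoʳ-≤ 2 (≤-trans (+-mono-≤ ñ≤8e ñ≤8e) (≤-reflexive (eight e))) ⟩
    2 ^ (16 * e)      ≤⟨ ^-monoʳ-≤ 2 (*-monoˡ-≤ e 16≤κ) ⟩
    2 ^ (κ * e)       ≡⟨ ^-*-assoc 2 κ e ⟨
    Λ ^ e             ∎
    where
    open ≤-Reasoning
    eight : ∀ e → 8 * e + 8 * e ≡ 16 * e
    eight = solve-∀

  good? : ∀ {N} (v : Vec (Fin M) N) S → Dec (Good S v)
  good? v S = 8 * excess v S <? ñ

  Supported : ∀ {N} → (Vec Bool N → ℕ) → Set
  Supported W = ∀ S → ñ < size S → W S ≡ 0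

  survivors : ∀ {N} → (Vec Bool N → ℕ) → Vec (Fin M) N → Vec Bool N → ℕ
  survivors W v S = W S unless good? v S

  survivors-supported : ∀ {N} {W : Vec Bool N → ℕ} v → Supported W → Supported (survivors W v)
  survivors-supported v supp S ñ<S with good? v S
  ... | yes _ = refl
  ... | no  _ = supp S ñ<S

  -- Markov's inequality: on the left each bad set counts at least `4 ^ ñ` times its weight, on the
  -- right every set counts at most `2 ^ ñ` times.
  survivors-bound : ∀ {N} (W : Vec Bool N → ℕ) v → Supported W →
    sumₛ (λ S → W S * Λ ^ excess v S) ≤ sumₛ (λ S → W S * 2 ^ size S) →
    2 ^ ñ * sumₛ (survivors W v) ≤ sumₛ W
  survivors-bound W v supp v-bound = *-cancelˡ-≤ (2 ^ ñ) (begin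
    2 ^ ñ * (2 ^ ñ * sumₛ W′)             ≡⟨ *-assoc (2 ^ ñ) (2 ^ ñ) (sumₛ W′) ⟨
    (2 ^ ñ * 2 ^ ñ) * sumₛ W′             ≡⟨ sumₛ-* (2 ^ ñ * 2 ^ ñ) W′ ⟨
    sumₛ (λ S → (2 ^ ñ * 2 ^ ñ) * W′ S)   ≤⟨ sumₛ-mono bad ⟩
    sumₛ (λ S → W S * Λ ^ excess v S)     ≤⟨ v-bound ⟩
    sumₛ (λ S → W S * 2 ^ size S)         ≤⟨ sumₛ-mono small ⟩
    sumₛ (λ S → 2 ^ ñ * W S)              ≡⟨ sumₛ-* (2 ^ ñ) W ⟩
    2 ^ ñ * sumₛ W                        ∎)
    where
    open ≤-Reasoning
    W′ = survivors W v
    instance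
      2^ñ≢0 : NonZero (2 ^ ñ)
      2^ñ≢0 = m^n≢0 2 ñ
    bad : ∀ S → (2 ^ ñ * 2 ^ ñ) * W′ S ≤ W S * Λ ^ excess v S
    bad S with good? v S
    ... | yes _ = ≤-trans (≤-reflexive (*-zeroʳ (2 ^ ñ * 2 ^ ñ))) z≤n
    ... | no ≮ñ = ≤-trans (≤-reflexive (*-comm (2 ^ ñ * 2 ^ ñ) (W S))) (*-monoʳ-≤ (W S) (^-bad (excess v S) (≮⇒≥ ≮ñ)))
    small : ∀ S → W S * 2 ^ size S ≤ 2 ^ ñ * W S
    small S with size S ≤? ñ
    ... | yes |S|≤ñ = ≤-trans (*-monoʳ-≤ (W S) (^-monoʳ-≤ 2 |S|≤ñ)) (≤-reflexive (*-comm (W S) (2 ^ ñ)))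
    ... | no  |S|≰ñ = ≤-trans (≤-reflexive (cong (_* 2 ^ size S) (supp S (≰⇒> |S|≰ñ)))) z≤n

  survivors-good : ∀ {N} {W : Vec Bool N → ℕ} {vs} v S →
    survivors W v S ≡ 0 ⊎ Any (Good S) vs → W S ≡ 0 ⊎ Any (Good S) (v ∷ vs)
  survivors-good v S (inj₂ later) = inj₂ (there later)
  survivors-good v S (inj₁ W′S≡0) with good? v S
  ... | yes good = inj₂ (here good)
  ... | no  _    = inj₁ W′S≡0

  -- Each further hash function divides the number of sets without a good one by 2^ñ.
  hashes-for : ∀ {N} d (W : Vec Bool N → ℕ) → Supported W → sumₛ W < (2 ^ ñ) ^ d →
    ∃ λ vs → length vs ≡ d × (∀ S → W S ≡ 0 ⊎ Any (Good S) vs)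
  -- Weights are natural numbers, so a total below 1 leaves no set of positive weight.
  hashes-for zero    W supp ΣW<1 = [] , refl , λ S → inj₁ (n<1⇒n≡0 (≤-<-trans (≤-sumₛ W S) ΣW<1))
  hashes-for (suc d) W supp ΣW< with hash-exists W supp
  ... | v , v-bound
    with hashes-for d (survivors W v) (survivors-supported {W = W} v supp)
           (*-cancelˡ-< (2 ^ ñ) _ _ (≤-<-trans (survivors-bound W v supp v-bound) ΣW<))
  ... | vs , len , good = v ∷ vs , cong suc len , λ S → survivors-good {W = W} v S (good S)

  isSmall : ∀ {N} → Vec Bool N → ℕ
  isSmall S = 1 unless (ñ <? size S)

  -- A small `S` satisfies `1 ≤ B ^ (ñ - size S)`, so the number of small sets is at most `B ^ ñ *
  -- (1 + 1/B) ^ N ≤ B ^ ñ * (1 + 1/B) ^ (B * ñ) ≤ (4 * B) ^ ñ`. The factor `B ^ (B *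
  -- ñ)` clears the denominators, and `r` pads the exponent from `N` to `B * ñ`.
  count-small : ∀ N ℓ → N ≤ 2 ^ suc ℓ * ñ → sumₛ {N} isSmall ≤ (4 * 2 ^ suc ℓ) ^ ñ
  count-small N ℓ N≤Bñ = *-cancelˡ-≤ (B ^ (B * ñ)) (begin
    B ^ (B * ñ) * sumₛ {N} isSmall            ≡⟨ cong (λ j → B ^ j * sumₛ {N} isSmall) (m∸n+n≡m N≤Bñ) ⟨
    B ^ (r + N) * sumₛ {N} isSmall            ≡⟨ cong (_* sumₛ {N} isSmall) (^-distribˡ-+-* B r N) ⟩
    B ^ r * B ^ N * sumₛ {N} isSmall          ≡⟨ *-assoc (B ^ r) (B ^ N) _ ⟩
    B ^ r * (B ^ N * sumₛ {N} isSmall)        ≡⟨ cong (B ^ r *_) (sumₛ-* {N} (B ^ N) isSmall) ⟨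
    B ^ r * sumₛ {N} (λ S → B ^ N * isSmall S) ≤⟨ *-mono-≤ (^-monoˡ-≤ r (n≤1+n B)) (sumₛ-mono pointwise) ⟩
    (1 + B) ^ r * sumₛ {N} (λ S → B ^ ñ * B ^ absent S) ≡⟨ cong ((1 + B) ^ r *_) (trans (sumₛ-* {N} (B ^ ñ) (λ S → B ^ absent S)) (cong (B ^ ñ *_) (sumₛ-absent N B))) ⟩
    (1 + B) ^ r * (B ^ ñ * (1 + B) ^ N)       ≡⟨ swap ((1 + B) ^ r) (B ^ ñ) _ ⟩
    B ^ ñ * ((1 + B) ^ r * (1 + B) ^ N)       ≡⟨ cong (B ^ ñ *_) (trans (sym (^-distribˡ-+-* (1 + B) r N)) (cong ((1 + B) ^_) (m∸n+n≡m N≤Bñ))) ⟩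
    B ^ ñ * (1 + B) ^ (B * ñ)                 ≡⟨ cong (B ^ ñ *_) (^-*-assoc (1 + B) B ñ) ⟨
    B ^ ñ * ((1 + B) ^ B) ^ ñ                 ≤⟨ *-monoʳ-≤ (B ^ ñ) (^-monoˡ-≤ ñ ([1+1/B]^B≤4 (2 ^ ℓ))) ⟩
    B ^ ñ * (4 * B ^ B) ^ ñ                   ≡⟨ cong (B ^ ñ *_) (^-distribʳ-* ñ 4 (B ^ B)) ⟩
    B ^ ñ * (4 ^ ñ * (B ^ B) ^ ñ)             ≡⟨ cong (λ z → B ^ ñ * (4 ^ ñ * z)) (^-*-assoc B B ñ) ⟩
    B ^ ñ * (4 ^ ñ * B ^ (B * ñ))             ≡⟨ rotate (B ^ ñ) (4 ^ ñ) (B ^ (B * ñ)) ⟩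
    B ^ (B * ñ) * (4 ^ ñ * B ^ ñ)             ≡⟨ cong (B ^ (B * ñ) *_) (^-distribʳ-* ñ 4 B) ⟨
    B ^ (B * ñ) * (4 * B) ^ ñ                 ∎)
    where
    open ≤-Reasoning
    B = 2 ^ suc ℓ
    r = B * ñ ∸ N
    instance
      2^ℓ≢0 : NonZero (2 ^ ℓ)
      2^ℓ≢0 = m^n≢0 2 ℓ
      B≢0 : NonZero B
      B≢0 = m^n≢0 2 (suc ℓ)
      B^Bñ≢0 : NonZero (B ^ (B * ñ))
      B^Bñ≢0 = m^n≢0 B (B * ñ)
    swap : ∀ a b c → a * (b * c) ≡ b * (a * c)
    swap = solve-∀
    rotate : ∀ a b c → a * (b * c) ≡ c * (b * a)
    rotate = solve-∀
    pointwise : (S : Vec Bool N) → B ^ N * isSmall S ≤ B ^ ñ * B ^ absent S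
    pointwise S with ñ <? size S
    ... | yes _   = ≤-trans (≤-reflexive (*-zeroʳ (B ^ N))) z≤n
    ... | no S≯ñ = begin
      B ^ N * 1               ≡⟨ *-identityʳ (B ^ N) ⟩
      B ^ N                   ≤⟨ ^-monoʳ-≤ B (≤-trans (≤-reflexive (trans (sym (absent+size S)) (+-comm (absent S) (size S)))) (+-monoˡ-≤ (absent S) (≮⇒≥ S≯ñ))) ⟩
      B ^ (ñ + absent S)      ≡⟨ ^-distribˡ-+-* B ñ (absent S) ⟩
      B ^ ñ * B ^ absent S    ∎

  isSmall-supported : ∀ {N} → Supported {N} isSmall
  isSmall-supported S ñ<S with ñ <? size S
  ... | yes _   = refl
  ... | no  S≯ñ = contradiction ñ<S S≯ñ

  isSmall≢0 : ∀ {N} (S : Vec Bool N) → size S ≤ ñ → isSmall S ≢ 0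
  isSmall≢0 S |S|≤ñ with ñ <? size S
  ... | yes ñ<S = contradiction |S|≤ñ (<⇒≱ ñ<S)
  ... | no  _   = λ ()

  hashes-exist : ∀ N ℓ → N ≤ 2 ^ suc ℓ * ñ →
    ∃ λ (vs : List (Vec (Fin M) N)) → length vs ≡ 4 + ℓ × (∀ S → size S ≤ ñ → Any (Good S) vs)
  hashes-exist N ℓ N≤ =
    map₂ (map₂ λ good S |S|≤ñ → fromInj₂ (λ S≡0 → contradiction S≡0 (isSmall≢0 S |S|≤ñ)) (good S))
      (hashes-for {N} (4 + ℓ) isSmall isSmall-supported Σ<)
    where
    open ≤-Reasoning
    Σ< : sumₛ {N} isSmall < (2 ^ ñ) ^ (4 + ℓ)
    Σ< = begin-strict
      sumₛ {N} isSmall        ≤⟨ count-small N ℓ N≤ ⟩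
      (4 * 2 ^ suc ℓ) ^ ñ     ≡⟨ cong (_^ ñ) (*-assoc 2 2 (2 ^ suc ℓ)) ⟩
      (2 ^ (3 + ℓ)) ^ ñ       ≡⟨ ^-*-assoc 2 (3 + ℓ) ñ ⟩
      -- One hash function beyond `3 + ℓ` makes the inequality strict, as `hashes-for` requires.
      2 ^ ((3 + ℓ) * ñ)       <⟨ ^-monoʳ-< 2 (s≤s (s≤s z≤n)) (*-monoˡ-< ñ (n<1+n (3 + ℓ))) ⟩
      2 ^ ((4 + ℓ) * ñ)       ≡⟨ cong (2 ^_) (*-comm (4 + ℓ) ñ) ⟩
      2 ^ (ñ * (4 + ℓ))       ≡⟨ ^-*-assoc 2 ñ (4 + ℓ) ⟨
      (2 ^ ñ) ^ (4 + ℓ)       ∎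

-- What a listener hears in one round.

Alone : ∀ {n} → (Fin n → Maybe Message) → Fin n → Message → Set
Alone f i m = f i ≡ just m × (∀ j → j ≢ i → f j ≡ nothing)

-- Includes the case that nobody transmits.
Crowded : ∀ {n} → (Fin n → Maybe Message) → Set
Crowded f = ∀ i m → f i ≡ just m → ∃ λ j → j ≢ i × ∃ λ m′ → f j ≡ just m′

heardFrom : ∀ {n} → (Fin n → Maybe Message) → Maybe Message
heardFrom {n} f = channel (mapMaybe f (allFin n))

data Transmitters {n} (f : Fin n → Maybe Message) (ms : List Message) : Set where
  none : (∀ i → f i ≡ nothing) → ms ≡ [] → Transmitters f ms
  one  : ∀ i m → Alone f i m → ms ≡ m ∷ [] → Transmitters f ms
  many : ∀ i j {m m′ ms′} → i ≢ j → (∃ λ a → f i ≡ just a) → (∃ λ a → f j ≡ just a) → ms ≡ m ∷ m′ ∷ ms′ → Transmitters f ms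

-- Stated for `catMaybes (tabulate f)` so that induction on `n` splits off one device at a time.
transmitters : ∀ {n} (f : Fin n → Maybe Message) → Transmitters f (catMaybes (tabulate f))
transmitters {zero}  f = none (λ ()) refl
transmitters {suc n} f with f zero in f0 | transmitters (f ∘ suc)
... | nothing | none all≡ ms≡ = none (λ { zero → f0 ; (suc i) → all≡ i }) ms≡
... | nothing | one i m (fi , rest) ms≡ =
  one (suc i) m (fi , λ { zero _ → f0 ; (suc j) j≢ → rest j (j≢ ∘ cong suc) }) ms≡
... | nothing | many i j i≢j fi fj ms≡ = many (suc i) (suc j) (i≢j ∘ fsuc-injective) fi fj ms≡
... | just m | none all≡ ms≡ =
  one zero m (f0 , λ { zero 0≢0 → contradiction refl 0≢0 ; (suc j) _ → all≡ j }) (cong (m ∷_) ms≡)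
... | just m | one i m′ (fi , _) ms≡ = many zero (suc i) (λ ()) (m , f0) (m′ , fi) (cong (m ∷_) ms≡)
... | just m | many i j i≢j fi fj ms≡ = many zero (suc i) (λ ()) (m , f0) fi (cong (m ∷_) ms≡)

Heard : ∀ {n} → (Fin n → Maybe Message) → Maybe Message → Set
Heard {n} f h = (∃ λ i → ∃ λ m → Alone f i m × h ≡ just m) ⊎ (Crowded f × h ≡ nothing)

-- A listener cannot tell a collision from the absence of transmitters, so three cases become two.
heard-cases : ∀ {n} (f : Fin n → Maybe Message) → Heard f (heardFrom f)
heard-cases {n} f = subst (λ ms → Heard f (channel (catMaybes ms))) (sym (map-tabulate id f)) (cases (transmitters f))
  where
  cases : ∀ {ms} → Transmitters f ms → Heard f (channel ms)
  cases (none all≡ refl) = inj₂ ((λ i m fi → contradiction (trans (sym (all≡ i)) fi) λ ()) , refl)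
  cases (one i m alone refl) = inj₁ (i , m , alone , refl)
  cases (many i j i≢j fi fj refl) = inj₂ (crowd , refl)
    where
    crowd : Crowded f
    crowd k m fk with k Fin.≟ i
    ... | yes refl = j , i≢j ∘ sym , fj
    ... | no  k≢i  = i , k≢i ∘ sym , fi

alone⇒¬crowded : ∀ {n} {f : Fin n → Maybe Message} {i m} → Alone f i m → ¬ Crowded f
alone⇒¬crowded (fi , rest) crowd with crowd _ _ fi
... | j , j≢i , m′ , fj = contradiction (trans (sym (rest j j≢i)) fj) λ ()

alone⇒heard : ∀ {n} (f : Fin n → Maybe Message) {i m} → Alone f i m → heardFrom f ≡ just m
alone⇒heard f {i} {m} alone with heardFrom f | heard-cases f
... | _ | inj₂ (crowd , _) = contradiction crowd (alone⇒¬crowded alone)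
... | _ | inj₁ (j , m′ , (fj , _) , refl) with j Fin.≟ i
...   | yes refl = trans (sym fj) (proj₁ alone)
...   | no j≢i   = contradiction (trans (sym (proj₂ alone j j≢i)) fj) λ ()

crowded⇒silence : ∀ {n} (f : Fin n → Maybe Message) → Crowded f → heardFrom f ≡ nothing
crowded⇒silence f crowd with heardFrom f | heard-cases f
... | _ | inj₁ (_ , _ , alone , _) = contradiction crowd (alone⇒¬crowded alone)
... | _ | inj₂ (_ , refl) = refl

nobody⇒silence : ∀ {n} (f : Fin n → Maybe Message) → (∀ i → f i ≡ nothing) → heardFrom f ≡ nothing
nobody⇒silence f all≡ = crowded⇒silence f (λ i m fi → contradiction (trans (sym (all≡ i)) fi) λ ())

-- Messages, states and rounds of the protocol.

encode : Bool → ℕ → Message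
encode false zero    = 0
encode true  zero    = 1
encode b     (suc e) = 2 + encode b e

decode : Message → Bool × ℕ
decode 0 = false , 0
decode 1 = true , 0
decode (suc (suc m)) = map₂ suc (decode m)

-- A message is the number `2 * e + b`: the bit is its parity, the counter its half.
decode-encode : ∀ b e → decode (encode b e) ≡ (b , e)
decode-encode false zero    = refl
decode-encode true  zero    = refl
decode-encode false (suc e) = cong (map₂ suc) (decode-encode false e)
decode-encode true  (suc e) = cong (map₂ suc) (decode-encode true e)

-- `hold k e`: on duty for the next k cells, when e cells of duty remain in the whole queue;
-- `wait j`: on duty after the next j + 1 cells.  `asked`, `claiming`, `serve` and `guard` occur
-- only inside a cell.
data State : Set where
  lost fresh asked claiming off : State
  wait       : (j : ℕ) → State
  hold guard : (k e : ℕ) → State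
  serve      : (k e : ℕ) (b : Bool) → State

-- In each cell the newcomers greet (`hello`); the device on duty reports how much duty is queued and
-- whether it heard a greeting (`ack`); newcomers that hear no report start a queue of their own (`claim`),
-- and devices on duty that hear such a claim quit.
data Round (M N : ℕ) : Set where
  hello                 : Vec (Fin M) N → Fin M → Round M N
  ack claim close final : Round M N

cell : ∀ {M N} → Vec (Fin M) N → Fin M → List (Round M N)
cell v p = hello v p ∷ ack ∷ claim ∷ []

cells : ∀ {M N m} → Vec (Fin M) N → (Fin m → Fin M) → List (Round M N)
cells {m = zero}  v g = []
cells {m = suc m} v g = cell v (g zero) ++ cells v (g ∘ suc)

phase : ∀ {M N} → Vec (Fin M) N → List (Round M N)
phase v = cells v id ++ close ∷ []

phases : ∀ {M N} → List (Vec (Fin M) N) → List (Round M N)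
phases []       = []
phases (v ∷ vs) = phase v ++ phases vs

perceive : Action → Maybe Message → Feedback
perceive listen h = h
perceive _      h = nothing

module Machine (c : ℕ) {M N : ℕ} where

  move : Round M N → Fin N → State → Action
  move (hello v p) i fresh            = if does (lookup v i Fin.≟ p) then transmit 0 else idle
  move (hello v p) i (hold (suc k) e) = listen
  move ack         i asked            = listen
  move ack         i (wait zero)      = listen
  move ack         i (serve k e b)    = transmit (encode b e)
  move claim       i claiming         = transmit 0
  move claim       i (guard k e)      = listen
  move close       i (hold (suc k) e) = transmit 0
  move close       i _                = listen
  move final       i lost             = listen
  move final       i _                = transmit 0
  move _           i _                = idle

  gain : Bool → ℕ
  gain b = if b then c else 0

  -- The argument is the duty queued ahead. If there is none, the newcomer takes over in the next
  -- cell; otherwise `suc j` cells pass first, which is `wait j`.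
  join : ℕ → State
  join zero    = hold c c
  join (suc j) = wait j

  answered : Bool × ℕ → State
  answered (true  , e) = join e
  answered (false , e) = off

  relieve : Bool × ℕ → State
  relieve (b , e) = hold c (e + gain b)

  next : Round M N → Fin N → State → Feedback → State
  next (hello v p) i fresh            f        = if does (lookup v i Fin.≟ p) then asked else fresh
  -- The current cell uses up one unit of the device's own duty and one of the total.
  next (hello v p) i (hold (suc k) e) f        = serve k (pred e) (is-just f)
  next ack         i asked            nothing  = claiming
  next ack         i asked            (just m) = answered (decode m)
  next ack         i (wait zero)      nothing  = off
  next ack         i (wait zero)      (just m) = relieve (decode m)
  next ack         i (wait (suc j))   f        = wait j
  next ack         i (serve k e b)    f        = guard k (e + gain b)
  next claim       i claiming         f        = hold c c
  next claim       i (guard k e)      nothing  = hold k e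
  -- A claim is made only where no report was heard: the queues on duty are jammed and yield to the
  -- lone claimer.
  next claim       i (guard k e)      (just m) = off
  next close       i lost             f        = lost
  -- A transmitter gets no feedback and goes on as `fresh` whether it won or collided; listeners are
  -- eliminated when a single device transmitted.
  next close       i (hold (suc k) e) f        = fresh
  next close       i s                nothing  = fresh
  next close       i s                (just m) = lost
  next _           i s                f        = s

  step : Round M N → Fin N → State → Maybe Message → State
  step r i s h = next r i s (perceive (move r i s) h)

  sends : Round M N → Fin N → State → Maybe Message
  sends r i s = isTransmit (move r i s)

  cellStep : Vec (Fin M) N → Fin M → Fin N → State → (h₁ h₂ h₃ : Maybe Message) → State
  cellStep v p i s h₁ h₂ h₃ = step claim i (step ack i (step (hello v p) i s h₁) h₂) h₃

  -- Effect of one cell on a single device.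

  claim-answered-silent : ∀ i z → sends claim i (answered z) ≡ nothing
  claim-answered-silent i (false , e)     = refl
  claim-answered-silent i (true , zero)   = refl
  claim-answered-silent i (true , suc e)  = refl

  claim-answered : ∀ i z h → step claim i (answered z) h ≡ answered z
  claim-answered i (false , e)     h = refl
  claim-answered i (true , zero)   h = refl
  claim-answered i (true , suc e)  h = refl

  -- Duty in the cell at offset `q`, where offset 0 is the next cell; `wait j` stands for duty at
  -- offsets `j + 1` to `j + c`.
  Covers : State → ℕ → Set
  Covers (hold k e) q = q < k
  Covers (wait j)   q = j < q × q ≤ j + c
  Covers _          q = ⊥

  -- The states between two cells of a proper queue. Only the device on duty must know the current
  -- total `e`; a spent device keeps an outdated one.
  data Queued (e : ℕ) : State → Set where
    fresh : Queued e fresh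
    off   : Queued e off
    wait  : ∀ j → Queued e (wait j)
    spent : ∀ e′ → Queued e (hold 0 e′)
    duty  : ∀ k → Queued e (hold (suc k) e)

  hold-queued : ∀ k e → Queued e (hold k e)
  hold-queued zero    e = spent e
  hold-queued (suc k) e = duty k

  answered-queued : ∀ b e → Queued (e + gain b) (answered (b , e))
  answered-queued false e       = off
  answered-queued true  zero    = hold-queued c c
  answered-queued true  (suc e) = wait e

  answered-covers : ∀ e {q} → e ≤ q → q < e + c → Covers (answered (true , e)) q
  answered-covers zero    e≤q q< = q<
  answered-covers (suc e) e≤q q< = e≤q , ≤-pred q<

  covers-answered : ∀ b e {q} → Covers (answered (b , e)) q → b ≡ true × e ≤ q × q < e + c
  covers-answered true zero    cov = refl , z≤n , cov
  covers-answered true (suc e) cov = refl , proj₁ cov , s≤s (proj₂ cov)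

  -- The states between two cells of a jam, where no report gets through and nobody waits.
  data Solo : State → Set where
    fresh : Solo fresh
    off   : Solo off
    hold  : ∀ k e → Solo (hold k e)

  module Cell (v : Vec (Fin M) N) (p : Fin M) where

    New : Fin N → State → Set
    New i s = s ≡ fresh × lookup v i ≡ p

    hello-sends : ∀ {i s} → New i s → sends (hello v p) i s ≡ just 0
    hello-sends {i} (refl , vi≡p) with lookup v i Fin.≟ p
    ... | yes _    = refl
    ... | no vi≢p = contradiction vi≡p vi≢p

    hello-new : ∀ i s {m} → sends (hello v p) i s ≡ just m → New i s
    hello-new i fresh eq with lookup v i Fin.≟ p
    ... | yes vi≡p = refl , vi≡p
    hello-new i fresh () | no _
    hello-new i (hold zero e) ()
    hello-new i (hold (suc k) e) ()

    fresh-stays : ∀ {i} h₁ h₂ h₃ → lookup v i ≢ p → cellStep v p i fresh h₁ h₂ h₃ ≡ fresh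
    fresh-stays {i} h₁ h₂ h₃ vi≢p with lookup v i Fin.≟ p
    ... | yes vi≡p = contradiction vi≡p vi≢p
    ... | no _     = refl

    -- With `suc e` cells of duty queued, the report carries the total `e` left after this cell, not
    -- yet counting a newcomer, and nobody claims.
    module Served (e : ℕ) (h₁ : Maybe Message) where

      b : Bool
      b = is-just h₁

      m : Message
      m = encode b e

      result : Fin N → State → State
      result i s = cellStep v p i s h₁ (just m) nothing

      ack-sends : ∀ {i s} → Queued (suc e) s → Covers s 0 → sends ack i (step (hello v p) i s h₁) ≡ just m
      ack-sends (duty k) _ = refl

      ack-silent : ∀ {i s} → Queued (suc e) s → ¬ Covers s 0 → sends ack i (step (hello v p) i s h₁) ≡ nothing
      ack-silent {i} fresh _ with lookup v i Fin.≟ p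
      ... | yes _ = refl
      ... | no  _ = refl
      ack-silent off          _  = refl
      ack-silent (wait zero)    _  = refl
      ack-silent (wait (suc j)) _  = refl
      ack-silent (spent e′)   _  = refl
      ack-silent (duty k)     ¬0 = contradiction z<s ¬0

      answer : State
      answer = answered (b , e)

      claim-silent : ∀ {i s} → Queued (suc e) s → sends claim i (step ack i (step (hello v p) i s h₁) (just m)) ≡ nothing
      claim-silent {i} fresh with lookup v i Fin.≟ p
      ... | no _ = refl
      ... | yes _ = claim-answered-silent i (decode m)
      claim-silent off            = refl
      claim-silent (wait zero)    = refl
      claim-silent (wait (suc j)) = refl
      claim-silent (spent e′)     = refl
      claim-silent (duty k)       = refl

      answer-final : ∀ i → step claim i (answered (decode m)) nothing ≡ answer
      answer-final i = trans (claim-answered i (decode m) nothing) (cong answered (decode-encode b e))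

      result-new : ∀ {i s} → New i s → result i s ≡ answer
      result-new {i} (refl , vi≡p) with lookup v i Fin.≟ p
      ... | no vi≢p = contradiction vi≡p vi≢p
      ... | yes _ = answer-final i

      result-relieved : ∀ i → result i (wait 0) ≡ hold c (e + gain b)
      result-relieved i rewrite decode-encode b e = refl

      result-queued : ∀ {i s} → Queued (suc e) s → Queued (e + gain b) (result i s)
      result-queued {i} fresh with lookup v i Fin.≟ p
      ... | yes _ = subst (Queued _) (sym (answer-final i)) (answered-queued b e)
      ... | no  _ = fresh
      result-queued off = off
      result-queued {i} (wait zero) = subst (Queued _) (sym (result-relieved i)) (hold-queued c _)
      result-queued (wait (suc j)) = wait j
      result-queued (spent e′) = spent e′
      result-queued (duty k) = hold-queued k _

      shift : ∀ {i s q} → Queued (suc e) s → Covers s (suc q) → Covers (result i s) q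
      shift {i} {q = q} (wait zero) (_ , q<c) = subst (λ s → Covers s q) (sym (result-relieved i)) q<c
      shift (wait (suc j)) (j<q , q≤) = ≤-pred j<q , ≤-pred q≤
      shift (duty k) q<k = ≤-pred q<k

      -- New duty lies at offsets from `e` on, behind everything queued before; this separation
      -- keeps the holder of each offset unique.
      unshift : ∀ {i s q} → Queued (suc e) s → Covers (result i s) q → Covers s (suc q) ⊎ (New i s × b ≡ true × e ≤ q × q < e + c)
      unshift {i} {q = q} fresh cov with lookup v i Fin.≟ p
      ... | yes vi≡p = inj₂ ((refl , vi≡p) , covers-answered b e (subst (λ s → Covers s q) (answer-final i) cov))
      unshift {i} {q = q} (wait zero) cov = inj₁ (z<s , subst (λ s → Covers s q) (result-relieved i) cov)
      unshift (wait (suc j)) (j<q , q≤) = inj₁ (s≤s j<q , s≤s q≤)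
      unshift (duty k) q<k = inj₁ (s≤s q<k)

    -- No report is heard, so newcomers claim. The outcome `h₃` stays a parameter of `result`, since
    -- a lone claim restarts the queue and anything else prolongs the jam.
    module Unserved (h₁ : Maybe Message) where

      ack-sends : ∀ {i s} → Solo s → Covers s 0 → ∃ λ m → sends ack i (step (hello v p) i s h₁) ≡ just m
      ack-sends (hold (suc k) e) _ = _ , refl

      ack-covers : ∀ {i s m} → Solo s → sends ack i (step (hello v p) i s h₁) ≡ just m → Covers s 0
      ack-covers {i} fresh eq with lookup v i Fin.≟ p
      ack-covers {i} fresh () | yes _
      ack-covers {i} fresh () | no _
      ack-covers (hold (suc k) e) _ = z<s

      claim-sends : ∀ {i s} → New i s → sends claim i (step ack i (step (hello v p) i s h₁) nothing) ≡ just 0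
      claim-sends {i} (refl , vi≡p) with lookup v i Fin.≟ p
      ... | yes _    = refl
      ... | no vi≢p = contradiction vi≡p vi≢p

      claim-new : ∀ {i s m} → Solo s → sends claim i (step ack i (step (hello v p) i s h₁) nothing) ≡ just m → New i s
      claim-new {i} fresh eq with lookup v i Fin.≟ p
      ... | yes vi≡p = refl , vi≡p
      claim-new {i} fresh () | no _
      claim-new (hold zero e) ()
      claim-new (hold (suc k) e) ()

      result : Fin N → State → Maybe Message → State
      result i s h₃ = cellStep v p i s h₁ nothing h₃

      result-new : ∀ {i s h₃} → New i s → result i s h₃ ≡ hold c c
      result-new {i} (refl , vi≡p) with lookup v i Fin.≟ p
      ... | yes _    = refl
      ... | no vi≢p = contradiction vi≡p vi≢p

      -- Old holders go `off` and spent ones have nothing left, so the claimer's queue remains the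
      -- only one. None of these devices is on duty, so any total `e` fits.
      quit : ∀ {i s m} → Solo s → ¬ New i s → (∀ e → Queued e (result i s (just m))) × (∀ q → ¬ Covers (result i s (just m)) q)
      quit {i} fresh ¬new with lookup v i Fin.≟ p
      ... | yes vi≡p = contradiction (refl , vi≡p) ¬new
      ... | no _     = (λ _ → fresh) , λ _ ()
      quit off              _ = (λ _ → off) , λ _ ()
      quit (hold zero e)    _ = (λ _ → spent e) , λ _ ()
      quit (hold (suc k) e) _ = (λ _ → off) , λ _ ()

      result-solo : ∀ {i s} → Solo s → Solo (result i s nothing)
      result-solo {i} fresh with lookup v i Fin.≟ p
      ... | yes _ = hold c c
      ... | no  _ = fresh
      result-solo off = off
      result-solo (hold zero e) = hold zero e
      result-solo (hold (suc k) e) = hold k _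

      shift : ∀ {i s q} → Solo s → Covers s (suc q) → Covers (result i s nothing) q
      shift (hold (suc k) e) q<k = ≤-pred q<k

      unshift : ∀ {i s q} → Solo s → Covers (result i s nothing) q → Covers s (suc q) ⊎ (New i s × q < c)
      unshift {i} fresh cov with lookup v i Fin.≟ p
      ... | yes vi≡p = inj₂ ((refl , vi≡p) , cov)
      unshift (hold (suc k) e) q<k = inj₁ (s≤s q<k)

-- The queue invariant of a whole configuration.

sum≡0 : ∀ {n} (f : Fin n → ℕ) → sum f ≡ 0 → ∀ i → f i ≡ 0
sum≡0 f Σ≡0 zero    = m+n≡0⇒m≡0 (f zero) Σ≡0
sum≡0 f Σ≡0 (suc i) = sum≡0 (f ∘ suc) (m+n≡0⇒n≡0 (f zero) Σ≡0) i

sum≡1 : ∀ {n} (f : Fin n → ℕ) → sum f ≡ 1 → ∃ λ i → f i ≡ 1 × (∀ j → j ≢ i → f j ≡ 0)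
sum≡1 {suc n} f Σ≡1 with f zero in f0
... | 1 = zero , f0 , λ { zero 0≢0 → contradiction refl 0≢0 ; (suc j) _ → sum≡0 (f ∘ suc) (suc-injective Σ≡1) j }
... | 0 with sum≡1 (f ∘ suc) Σ≡1
...   | i , fi , rest = suc i , fi , λ { zero _ → f0 ; (suc j) j≢ → rest j (j≢ ∘ cong suc) }

δ≡1 : ∀ {m} (x y : Fin m) → δ x y ≡ 1 → x ≡ y
δ≡1 x y eq with x Fin.≟ y
... | yes x≡y = x≡y

δ≡0 : ∀ {m} (x y : Fin m) → δ x y ≡ 0 → x ≢ y
δ≡0 x y eq with x Fin.≟ y
... | no x≢y = x≢y

single-cases : ∀ k → single k ≡ 0 ⊎ k ≡ 1
single-cases 0             = inj₁ refl
single-cases 1             = inj₂ refl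
single-cases (suc (suc k)) = inj₁ refl

module Global (c : ℕ) .{{_ : NonZero c}} {M N n : ℕ} (ids : Fin n → Fin N) where

  open Machine c {M} {N}

  Conf : Set
  Conf = Fin n → State

  signals : Round M N → Conf → Fin n → Maybe Message
  signals r σ j = sends r (ids j) (σ j)

  heard : Round M N → Conf → Maybe Message
  heard r σ = heardFrom (signals r σ)

  after : Round M N → Conf → Conf
  after r σ i = step r (ids i) (σ i) (heard r σ)

  run : List (Round M N) → Conf → Conf
  run []       σ = σ
  run (r ∷ rs) σ = run rs (after r σ)

  record Proper (σ : Conf) (e : ℕ) : Set where
    field
      queued    : ∀ i → Queued e (σ i)
      covered   : ∀ q → q < e → ∃ λ i → Covers (σ i) q
      bounded   : ∀ {q} i → Covers (σ i) q → q < e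
      unique    : ∀ {q} i j → Covers (σ i) q → Covers (σ j) q → i ≡ j

  -- Several queues started in the same cell jam each other; they all give way to the next lone newcomer.
  record Jammed (σ : Conf) : Set where
    field
      solo : ∀ i → Solo (σ i)
      twin : ∀ {q} i → Covers (σ i) q → ∃ λ j → j ≢ i × Covers (σ j) q

  -- Every lone newcomer so far has contributed c cells of duty, all of which have been
  -- either used up or are still in the queue.
  data Invariant (σ : Conf) (credit time : ℕ) : Set where
    proper : ∀ e → Proper σ e → credit ≤ time + e → Invariant σ credit time
    jammed : Jammed σ → credit ≤ time → Invariant σ credit time

  proper-resp : ∀ {σ τ e} → (∀ i → τ i ≡ σ i) → Proper σ e → Proper τ e
  proper-resp {σ} {τ} {e} τ≡σ P = record
    { queued  = λ i → subst (Queued e) (sym (τ≡σ i)) (queued i)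
    ; covered = λ q q<e → map₂ (λ {i} → subst (λ s → Covers s q) (sym (τ≡σ i))) (covered q q<e)
    ; bounded = λ {q} i cov → bounded i (subst (λ s → Covers s q) (τ≡σ i) cov)
    ; unique  = λ {q} i j ci cj → unique i j (subst (λ s → Covers s q) (τ≡σ i) ci) (subst (λ s → Covers s q) (τ≡σ j) cj)
    }
    where open Proper P

  jammed-resp : ∀ {σ τ} → (∀ i → τ i ≡ σ i) → Jammed σ → Jammed τ
  jammed-resp {σ} {τ} τ≡σ J = record
    { solo = λ i → subst Solo (sym (τ≡σ i)) (solo i)
    ; twin = λ {q} i cov → map₂ (λ {j} → map₂ (subst (λ s → Covers s q) (sym (τ≡σ j)))) (twin i (subst (λ s → Covers s q) (τ≡σ i) cov))
    }
    where open Jammed J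

  -- An empty queue is a jam without holders. Nobody can be in `wait j`, since with `c` positive
  -- such a device would cover offset `j + 1`.
  proper0⇒jammed : ∀ {σ} → Proper σ 0 → Jammed σ
  proper0⇒jammed {σ} P = record { solo = λ i → solo i (queued i) ; twin = λ i cov → contradiction (bounded i cov) λ () }
    where
    open Proper P
    solo : ∀ i {s} → Queued 0 s → {{σ i ≡ s}} → Solo s
    solo i fresh = fresh
    solo i off = off
    solo i (wait j) {{eq}} = contradiction (bounded i (subst (λ s → Covers s (suc j)) (sym eq) (n<1+n j , m<m+n j (>-nonZero⁻¹ c)))) λ ()
    solo i (spent e) = hold 0 e
    solo i (duty k) = hold (suc k) 0

  module _ (v : Vec (Fin M) N) where

    w : Fin n → Fin M
    w i = lookup v (ids i)

    load : Fin M → ℕ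
    load p = sum (λ i → δ (w i) p)

    module _ (p : Fin M) {σ : Conf} (news : ∀ i → w i ≡ p → σ i ≡ fresh) where

      open Cell v p

      h₁ : Maybe Message
      h₁ = heard (hello v p) σ

      σ₁ = after (hello v p) σ
      σ₂ = after ack σ₁

      New′ : Fin n → Set
      New′ i = New (ids i) (σ i)

      lone-newcomer : load p ≡ 1 → ∃ λ i → New′ i × (∀ j → New′ j → j ≡ i)
      lone-newcomer load≡1 with sum≡1 (λ i → δ (w i) p) load≡1
      ... | i , δi , rest = i , (news i wi≡p , wi≡p) , only
        where
        wi≡p = δ≡1 (w i) p δi
        only : ∀ j → New′ j → j ≡ i
        only j (_ , wj≡p) with j Fin.≟ i
        ... | yes j≡i = j≡i
        ... | no j≢i  = contradiction wj≡p (δ≡0 (w j) p (rest j j≢i))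

      module _ {e} (P : Proper σ (suc e)) where

        open Proper P
        open Served e h₁

        holder : ∃ λ i → Covers (σ i) 0
        holder = covered 0 z<s

        -- Exactly one device covers offset 0, so its report is not disturbed.
        heard-ack : heard ack σ₁ ≡ just m
        heard-ack = alone⇒heard (signals ack σ₁) {proj₁ holder}
          (ack-sends (queued _) (proj₂ holder) , λ j j≢ → ack-silent (queued j) (λ cov → j≢ (unique _ _ cov (proj₂ holder))))

        σ′ : Conf
        σ′ i = result (ids i) (σ i)

        σ₂≡ : ∀ i → σ₂ i ≡ step ack (ids i) (σ₁ i) (just m)
        σ₂≡ i = cong (step ack (ids i) (σ₁ i)) heard-ack

        heard-claim : heard claim σ₂ ≡ nothing
        heard-claim = nobody⇒silence (signals claim σ₂) (λ i → trans (cong (sends claim (ids i)) (σ₂≡ i)) (claim-silent (queued i)))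

        run≡σ′ : ∀ i → run (cell v p) σ i ≡ σ′ i
        run≡σ′ i = cong₂ (step claim (ids i)) (σ₂≡ i) heard-claim

        newcomer : b ≡ true → ∃ λ i → New′ i × (∀ j → New′ j → j ≡ i)
        newcomer b≡true with h₁ | heard-cases (signals (hello v p) σ)
        newcomer () | _ | inj₂ (_ , refl)
        ... | _ | inj₁ (i , _ , (fi , rest) , refl) = i , hello-new (ids i) (σ i) fi , only
          where
          only : ∀ j → New′ j → j ≡ i
          only j new with j Fin.≟ i
          ... | yes j≡i = j≡i
          ... | no j≢i  = contradiction (trans (sym (rest j j≢i)) (hello-sends new)) λ ()

        σ′-proper : Proper σ′ (e + gain b)
        σ′-proper = record { queued = λ i → result-queued (queued i) ; covered = covered′ ; bounded = bounded′ ; unique = unique′ }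
          where
          gained : ∀ b′ {q} → ¬ q < e → q < e + gain b′ → b′ ≡ true × q < e + c
          gained true  q≮e q< = refl , q<
          gained false q≮e q< = contradiction (subst (_ <_) (+-identityʳ e) q<) q≮e
          covered′ : ∀ q → q < e + gain b → ∃ λ i → Covers (σ′ i) q
          covered′ q q< with q <? e
          ... | yes q<e = map₂ (λ {i} cov → shift (queued i) cov) (covered (suc q) (s≤s q<e))
          ... | no q≮e with gained b q≮e q<
          ...   | b≡true , q<e+c with newcomer b≡true
          ...     | i , new , _ = i , subst (λ s → Covers s q) (sym (result-new new))
                      (subst (λ z → Covers (answered (z , e)) q) (sym b≡true) (answered-covers e (≮⇒≥ q≮e) q<e+c))
          bounded′ : ∀ {q} i → Covers (σ′ i) q → q < e + gain b
          bounded′ i cov with unshift (queued i) cov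
          ... | inj₁ cov′ = ≤-trans (≤-pred (bounded i cov′)) (m≤m+n e _)
          ... | inj₂ (_ , b≡ , _ , q<) = subst (λ z → _ < e + gain z) (sym b≡) q<
          unique′ : ∀ {q} i j → Covers (σ′ i) q → Covers (σ′ j) q → i ≡ j
          unique′ i j ci cj with unshift (queued i) ci | unshift (queued j) cj
          ... | inj₁ ci′ | inj₁ cj′ = unique i j ci′ cj′
          -- Duty queued earlier ends before offset `e`, where the newcomer's begins.
          ... | inj₁ ci′ | inj₂ (_ , _ , e≤q , _) = contradiction (≤-pred (bounded i ci′)) (≤⇒≯ e≤q)
          ... | inj₂ (_ , _ , e≤q , _) | inj₁ cj′ = contradiction (≤-pred (bounded j cj′)) (≤⇒≯ e≤q)
          ... | inj₂ (ni , b≡ , _) | inj₂ (nj , _) with newcomer b≡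
          ...   | k , _ , only = trans (only i ni) (sym (only j nj))

        -- A device alone in its cell is the only one to greet, so its greeting is heard and the
        -- report has `b` true.
        gain-bound : c * single (load p) ≤ gain b
        gain-bound with single-cases (load p)
        ... | inj₁ single≡0 = ≤-trans (≤-reflexive (trans (cong (c *_) single≡0) (*-zeroʳ c))) z≤n
        ... | inj₂ load≡1 with lone-newcomer load≡1
        ...   | i , new , only = ≤-reflexive (trans (trans (cong (λ k → c * single k) load≡1) (*-identityʳ c)) (cong (λ h → gain (is-just h)) (sym h₁≡)))
          where
          quiet : ∀ j → j ≢ i → signals (hello v p) σ j ≡ nothing
          quiet j j≢i with signals (hello v p) σ j in eq
          ... | nothing = refl
          ... | just _  = contradiction (only j (hello-new (ids j) (σ j) eq)) j≢i
          h₁≡ : h₁ ≡ just 0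
          h₁≡ = alone⇒heard (signals (hello v p) σ) {i} (hello-sends new , quiet)

        proper-cell : ∀ {credit time} → credit ≤ time + suc e → Invariant (run (cell v p) σ) (credit + c * single (load p)) (suc time)
        proper-cell {credit} {time} credit≤ = proper (e + gain b) (proper-resp run≡σ′ σ′-proper) (begin
          credit + c * single (load p)   ≤⟨ +-mono-≤ credit≤ gain-bound ⟩
          (time + suc e) + gain b        ≡⟨ cong (_+ gain b) (+-suc time e) ⟩
          suc (time + e + gain b)        ≡⟨ cong suc (+-assoc time e _) ⟩
          suc time + (e + gain b)        ∎)
          where open ≤-Reasoning

      module _ (J : Jammed σ) where

        open Jammed J
        open Unserved h₁

        -- Every device on duty has a twin on duty in the same cell, so no report is ever alone.
        heard-nack : heard ack σ₁ ≡ nothing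
        heard-nack = crowded⇒silence (signals ack σ₁) crowd
          where
          crowd : Crowded (signals ack σ₁)
          crowd i m fi with twin i (ack-covers (solo i) fi)
          ... | j , j≢i , cov = j , j≢i , ack-sends (solo j) cov

        σ₂≡′ : ∀ i → σ₂ i ≡ step ack (ids i) (σ₁ i) nothing
        σ₂≡′ i = cong (step ack (ids i) (σ₁ i)) heard-nack

        h₃ : Maybe Message
        h₃ = heard claim σ₂

        run≡ : ∀ i → run (cell v p) σ i ≡ result (ids i) (σ i) h₃
        run≡ i = cong (λ s → step claim (ids i) s h₃) (σ₂≡′ i)

        claims : ∀ {i} → New′ i → signals claim σ₂ i ≡ just 0
        claims {i} new = trans (cong (sends claim (ids i)) (σ₂≡′ i)) (claim-sends new)

        claimers : ∀ {i m} → signals claim σ₂ i ≡ just m → New′ i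
        claimers {i} eq = claim-new (solo i) (trans (sym (cong (sends claim (ids i)) (σ₂≡′ i))) eq)

        -- A lone claim starts a queue of `c` cells, enough for the credit of this cell. Otherwise
        -- several claimers or none leave a jam; a lone newcomer would have claimed alone, so the
        -- cell earns no credit.
        jammed-cell : ∀ {credit time} → credit ≤ time → Invariant (run (cell v p) σ) (credit + c * single (load p)) (suc time)
        jammed-cell {credit} {time} credit≤ with heard-cases (signals claim σ₂)
        -- The hypothesis `credit ≤ time` counts no duty of the jammed holders, so discarding it
        -- costs nothing.
        ... | inj₁ (i , m , (fi , rest) , h₃≡) = proper c restart (begin
            credit + c * single (load p)    ≤⟨ +-mono-≤ credit≤ (≤-trans (*-monoʳ-≤ c (single≤1 (load p))) (≤-reflexive (*-identityʳ c))) ⟩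
            time + c                        ≤⟨ n≤1+n _ ⟩
            suc time + c                    ∎)
          where
          open ≤-Reasoning
          single≤1 : ∀ k → single k ≤ 1
          single≤1 0             = z≤n
          single≤1 1             = ≤-refl
          single≤1 (suc (suc k)) = z≤n
          run≡₁ : ∀ j → run (cell v p) σ j ≡ result (ids j) (σ j) (just m)
          run≡₁ j = trans (run≡ j) (cong (result (ids j) (σ j)) h₃≡)
          run-i : run (cell v p) σ i ≡ hold c c
          run-i = trans (run≡₁ i) (result-new (claimers fi))
          run-j : ∀ j → j ≢ i → (∀ e → Queued e (run (cell v p) σ j)) × (∀ q → ¬ Covers (run (cell v p) σ j) q)
          run-j j j≢i rewrite run≡₁ j = quit (solo j) (λ new → contradiction (trans (sym (rest j j≢i)) (claims new)) λ ())
          only : ∀ {q} j → Covers (run (cell v p) σ j) q → j ≡ i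
          only j cov with j Fin.≟ i
          ... | yes j≡i = j≡i
          ... | no j≢i = contradiction cov (proj₂ (run-j j j≢i) _)
          restart : Proper (run (cell v p) σ) c
          restart = record
            { queued  = queued
            ; covered = λ q q<c → i , subst (λ s → Covers s q) (sym run-i) q<c
            ; bounded = λ {q} j cov → subst (λ s → Covers s q) run-i (subst (λ j → Covers (run (cell v p) σ j) q) (only j cov) cov)
            ; unique  = λ j k cj ck → trans (only j cj) (sym (only k ck))
            }
            where
            queued : ∀ j → Queued c (run (cell v p) σ j)
            queued j with j Fin.≟ i
            ... | yes refl = subst (Queued c) (sym run-i) (hold-queued c c)
            ... | no j≢i   = proj₁ (run-j j j≢i) c
        ... | inj₂ (crowd , h₃≡) = jammed (jammed-resp run≡₀ (record { solo = λ i → result-solo (solo i) ; twin = twin′ })) bound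
          where
          run≡₀ : ∀ j → run (cell v p) σ j ≡ result (ids j) (σ j) nothing
          run≡₀ j = trans (run≡ j) (cong (result (ids j) (σ j)) h₃≡)
          twin′ : ∀ {q} i → Covers (result (ids i) (σ i) nothing) q → ∃ λ j → j ≢ i × Covers (result (ids j) (σ j) nothing) q
          twin′ {q} i cov with unshift (solo i) cov
          ... | inj₁ cov′ = map₂ (λ {j} → map₂ (shift (solo j))) (twin i cov′)
          ... | inj₂ (new , q<c) with crowd i 0 (claims new)
          ...   | j , j≢i , _ , fj = j , j≢i , subst (λ s → Covers s q) (sym (result-new (claimers fj))) q<c
          bound : credit + c * single (load p) ≤ suc time
          bound with single-cases (load p)
          ... | inj₁ single≡0 = ≤-trans (≤-reflexive (trans (cong (λ k → credit + c * k) single≡0) (trans (cong (credit +_) (*-zeroʳ c)) (+-identityʳ credit)))) (m≤n⇒m≤1+n credit≤)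
          ... | inj₂ load≡1 with lone-newcomer load≡1
          ...   | i , new , only with crowd i 0 (claims new)
          ...     | j , j≢i , _ , fj = contradiction (only j (claimers fj)) j≢i

      cell-invariant : ∀ {credit time} → Invariant σ credit time → Invariant (run (cell v p) σ) (credit + c * single (load p)) (suc time)
      cell-invariant (proper (suc e) P credit≤) = proper-cell P credit≤
      cell-invariant {time = time} (proper zero P credit≤) = jammed-cell (proper0⇒jammed P) (≤-trans credit≤ (≤-reflexive (+-identityʳ time)))
      cell-invariant (jammed J credit≤)         = jammed-cell J credit≤

-- Survival and energy of a single device.

module Lifetime (c : ℕ) {M N : ℕ} where

  open Machine c {M} {N}

  answered-unlost : ∀ z → answered z ≢ lost
  answered-unlost (false , e)     ()
  answered-unlost (true , zero)   ()
  answered-unlost (true , suc e)  ()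

  -- Only `close` eliminates devices; this lemma and the next two check the three rounds of a cell.
  hello-unlost : ∀ {v p} i {s} h → s ≢ lost → step (hello v p) i s h ≢ lost
  hello-unlost i {lost} h s≢ eq = s≢ refl
  hello-unlost {v} {p} i {fresh} h s≢ eq with lookup v i Fin.≟ p
  hello-unlost i {fresh} h s≢ () | yes _
  hello-unlost i {fresh} h s≢ () | no _
  hello-unlost i {hold zero e} h s≢ ()
  hello-unlost i {hold (suc k) e} h s≢ ()

  ack-unlost : ∀ i {s} h → s ≢ lost → step ack i s h ≢ lost
  ack-unlost i {lost} h s≢ eq = s≢ refl
  ack-unlost i {asked} (just m) s≢ eq = answered-unlost (decode m) eq
  ack-unlost i {asked} nothing s≢ ()
  ack-unlost i {wait zero} (just m) s≢ ()
  ack-unlost i {wait zero} nothing s≢ ()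
  ack-unlost i {wait (suc j)} h s≢ ()

  claim-unlost : ∀ i {s} h → s ≢ lost → step claim i s h ≢ lost
  claim-unlost i {lost} h s≢ eq = s≢ refl
  claim-unlost i {guard k e} (just m) s≢ ()
  claim-unlost i {guard k e} nothing s≢ ()

  close-resets : ∀ i s → s ≢ lost → step close i s nothing ≡ fresh
  close-resets i lost             s≢ = contradiction refl s≢
  close-resets i fresh            s≢ = refl
  close-resets i asked            s≢ = refl
  close-resets i claiming         s≢ = refl
  close-resets i off              s≢ = refl
  close-resets i (wait j)         s≢ = refl
  close-resets i (hold zero e)    s≢ = refl
  close-resets i (hold (suc k) e) s≢ = refl
  close-resets i (guard k e)      s≢ = refl
  close-resets i (serve k e b)    s≢ = refl

  close-winner : ∀ i s {m} h → sends close i s ≡ just m → step close i s h ≢ lost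
  close-winner i (hold (suc k) e) h _ ()
  close-winner i lost h () _
  close-winner i (hold zero e) h () _

  close-loser : ∀ i s m → sends close i s ≡ nothing → step close i s (just m) ≡ lost
  close-loser i lost          m _ = refl
  close-loser i fresh         m _ = refl
  close-loser i asked         m _ = refl
  close-loser i claiming      m _ = refl
  close-loser i off           m _ = refl
  close-loser i (wait j)      m _ = refl
  close-loser i (hold zero e) m _ = refl
  close-loser i (guard k e)   m _ = refl
  close-loser i (serve k e b) m _ = refl

  close-sends : ∀ i {s e} → Queued e s → Covers s 0 → sends close i s ≡ just 0
  close-sends i (duty k) _ = refl

  close-silent : ∀ i {s e} → Queued e s → ¬ Covers s 0 → sends close i s ≡ nothing
  close-silent i fresh    ¬0 = refl
  close-silent i off      ¬0 = refl
  close-silent i (wait j) ¬0 = refl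
  close-silent i (spent e) ¬0 = refl
  close-silent i (duty k) ¬0 = contradiction z<s ¬0

  lost-stays : ∀ r i h → step r i lost h ≡ lost
  lost-stays (hello v p) i h = refl
  lost-stays ack         i h = refl
  lost-stays claim       i h = refl
  lost-stays close       i h = refl
  lost-stays final       i h = refl

  cost : Action → ℕ
  cost a = if isIdle a then 0 else 1

  -- Bounds the energy that a device can still spend in the current phase before `close`.
  reserve : State → ℕ
  reserve fresh         = 3 + 3 * c
  reserve asked         = 2 + 3 * c
  reserve claiming      = 1 + 3 * c
  reserve (wait j)      = 1 + 3 * c
  reserve (hold k e)    = 3 * k
  reserve (serve k e b) = 2 + 3 * k
  reserve (guard k e)   = 1 + 3 * k
  reserve lost          = 0
  reserve off           = 0

  answered-reserve : ∀ z → reserve (answered z) ≤ 1 + 3 * c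
  answered-reserve (false , e)    = z≤n
  answered-reserve (true , zero)  = n≤1+n _
  answered-reserve (true , suc e) = ≤-refl

  -- `reserve` is a potential from which each round of a cell pays its cost: a cell on duty takes
  -- three active rounds, and a newcomer needs at most three more before its duty starts.
  hello-cost : ∀ {v p} i s h → cost (move (hello v p) i s) + reserve (step (hello v p) i s h) ≤ reserve s
  hello-cost {v} {p} i fresh h with lookup v i Fin.≟ p
  ... | yes _ = ≤-refl
  ... | no  _ = ≤-refl
  hello-cost i lost h = ≤-refl
  hello-cost i asked h = ≤-refl
  hello-cost i claiming h = ≤-refl
  hello-cost i off h = ≤-refl
  hello-cost i (wait j) h = ≤-refl
  hello-cost i (hold zero e) h = ≤-refl
  hello-cost i (hold (suc k) e) h = ≤-reflexive (sym (*-suc 3 k))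
  hello-cost i (guard k e) h = ≤-refl
  hello-cost i (serve k e b) h = ≤-refl

  ack-cost : ∀ i s h → cost (move ack i s) + reserve (step ack i s h) ≤ reserve s
  ack-cost i lost h = ≤-refl
  ack-cost i fresh h = ≤-refl
  ack-cost i asked nothing = ≤-refl
  ack-cost i asked (just m) = s≤s (answered-reserve (decode m))
  ack-cost i claiming h = ≤-refl
  ack-cost i off h = ≤-refl
  ack-cost i (wait zero) nothing = s≤s z≤n
  ack-cost i (wait zero) (just m) = ≤-refl
  ack-cost i (wait (suc j)) h = ≤-refl
  ack-cost i (hold k e) h = ≤-refl
  ack-cost i (guard k e) h = ≤-refl
  ack-cost i (serve k e b) h = ≤-refl

  claim-cost : ∀ i s h → cost (move claim i s) + reserve (step claim i s h) ≤ reserve s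
  claim-cost i lost h = ≤-refl
  claim-cost i fresh h = ≤-refl
  claim-cost i asked h = ≤-refl
  claim-cost i claiming h = ≤-refl
  claim-cost i off h = ≤-refl
  claim-cost i (wait j) h = ≤-refl
  claim-cost i (hold k e) h = ≤-refl
  claim-cost i (guard k e) nothing = ≤-refl
  claim-cost i (guard k e) (just m) = s≤s z≤n
  claim-cost i (serve k e b) h = ≤-refl

  cost≤1 : ∀ a → cost a ≤ 1
  cost≤1 idle         = z≤n
  cost≤1 listen       = ≤-refl
  cost≤1 (transmit m) = ≤-refl

  close-reserve : ∀ i s h → reserve (step close i s h) ≤ reserve fresh
  close-reserve i lost             h        = z≤n
  close-reserve i (hold (suc k) e) h        = ≤-refl
  close-reserve i fresh            nothing  = ≤-refl
  close-reserve i asked            nothing  = ≤-refl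
  close-reserve i claiming         nothing  = ≤-refl
  close-reserve i off              nothing  = ≤-refl
  close-reserve i (wait j)         nothing  = ≤-refl
  close-reserve i (hold zero e)    nothing  = ≤-refl
  close-reserve i (guard k e)      nothing  = ≤-refl
  close-reserve i (serve k e b)    nothing  = ≤-refl
  close-reserve i fresh            (just m) = z≤n
  close-reserve i asked            (just m) = z≤n
  close-reserve i claiming         (just m) = z≤n
  close-reserve i off              (just m) = z≤n
  close-reserve i (wait j)         (just m) = z≤n
  close-reserve i (hold zero e)    (just m) = z≤n
  close-reserve i (guard k e)      (just m) = z≤n
  close-reserve i (serve k e b)    (just m) = z≤n

-- From cells to phases.

module Phases (c : ℕ) .{{_ : NonZero c}} {M N n : ℕ} (ids : Fin n → Fin N) where

  open Machine c {M} {N}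
  open Lifetime c {M} {N}
  open Global c {M} ids

  Won : Conf → Set
  Won σ = ∃ λ ℓ → σ ℓ ≢ lost × (∀ j → j ≢ ℓ → σ j ≡ lost)

  AllFresh : Conf → Set
  AllFresh σ = ∀ i → σ i ≡ fresh

  run-++ : ∀ xs ys σ → run (xs ++ ys) σ ≡ run ys (run xs σ)
  run-++ []       ys σ = refl
  run-++ (x ∷ xs) ys σ = run-++ xs ys (after x σ)

  alone⇒won : ∀ {σ i m} → Alone (signals close σ) i m → Won (after close σ)
  alone⇒won {σ} {i} {m} alone@(fi , rest) = i , close-winner (ids i) (σ i) _ fi , λ j j≢i →
    trans (cong (step close (ids j) (σ j)) (alone⇒heard (signals close σ) alone)) (close-loser (ids j) (σ j) m (rest j j≢i))

  -- Elimination requires that one device transmitted alone, and that device survives; otherwise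
  -- everybody starts the next phase afresh. So a bad hash function does no harm.
  after-close : ∀ {σ} → (∀ i → σ i ≢ lost) → AllFresh (after close σ) ⊎ Won (after close σ)
  after-close {σ} unlost with heard-cases (signals close σ)
  ... | inj₁ (_ , _ , alone , _) = inj₂ (alone⇒won {σ} alone)
  ... | inj₂ (_ , silent) = inj₁ (λ i → trans (cong (step close (ids i) (σ i)) silent) (close-resets (ids i) (σ i) (unlost i)))

  cells-unlost : ∀ {m} v (g : Fin m → Fin M) σ → (∀ i → σ i ≢ lost) → ∀ i → run (cells v g) σ i ≢ lost
  cells-unlost {zero}  v g σ unlost = unlost
  cells-unlost {suc m} v g σ unlost = cells-unlost v (g ∘ suc) _ λ i →
    claim-unlost (ids i) _ (ack-unlost (ids i) _ (hello-unlost (ids i) _ (unlost i)))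

  phase-fresh : ∀ v {σ} → AllFresh σ → AllFresh (run (phase v) σ) ⊎ Won (run (phase v) σ)
  phase-fresh v {σ} allFresh rewrite run-++ (cells v id) (close ∷ []) σ =
    after-close (cells-unlost v id σ λ i σi≡lost → contradiction (trans (sym (allFresh i)) σi≡lost) λ ())

  -- Losers never transmit, so a survivor that listens in `close` hears silence and is not
  -- eliminated.
  won-after : ∀ r {σ} → Won σ → Won (after r σ)
  won-after r {σ} (ℓ , ℓ≢lost , losers) = ℓ , winner r , λ j j≢ℓ → trans (cong (λ s → step r (ids j) s (heard r σ)) (losers j j≢ℓ)) (lost-stays r (ids j) (heard r σ))
    where
    winner : ∀ r → after r σ ℓ ≢ lost
    winner (hello v p) = hello-unlost (ids ℓ) _ ℓ≢lost
    winner ack         = ack-unlost (ids ℓ) _ ℓ≢lost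
    winner claim       = claim-unlost (ids ℓ) _ ℓ≢lost
    winner final       = ℓ≢lost
    winner close with signals close σ ℓ in eq
    ... | just m  = close-winner (ids ℓ) (σ ℓ) _ eq
    ... | nothing = λ lost≡ → contradiction (trans (sym (close-resets (ids ℓ) (σ ℓ) ℓ≢lost)) (trans (cong (step close (ids ℓ) (σ ℓ)) (sym silent)) lost≡)) λ ()
      where
      nobody : ∀ j → signals close σ j ≡ nothing
      nobody j with j Fin.≟ ℓ
      ... | yes refl = eq
      ... | no j≢ℓ   = cong (sends close (ids j)) (losers j j≢ℓ)
      silent : heard close σ ≡ nothing
      silent = nobody⇒silence (signals close σ) nobody

  won-run : ∀ rs {σ} → Won σ → Won (run rs σ)
  won-run []       won = won
  won-run (r ∷ rs) won = won-run rs (won-after r won)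

  -- As `g` is injective, each cell is visited once, and the devices of later cells are still
  -- `fresh` when their turn comes.
  cells-invariant : ∀ {m credit time} v (g : Fin m → Fin M) {σ} → Injective _≡_ _≡_ g →
    (∀ i k → w v i ≡ g k → σ i ≡ fresh) → Invariant σ credit time →
    Invariant (run (cells v g) σ) (credit + c * sum (λ k → single (load v (g k)))) (time + m)
  cells-invariant {zero} {credit} {time} v g g-inj news inv =
    subst₂ (Invariant _) (sym (trans (cong (credit +_) (*-zeroʳ c)) (+-identityʳ credit))) (sym (+-identityʳ time)) inv
  cells-invariant {suc m} {credit} {time} v g {σ} g-inj news inv =
    subst₂ (Invariant _) (regroup credit c (single (load v (g zero))) _) (sym (+-suc time m))
      (cells-invariant v (g ∘ suc) (λ eq → fsuc-injective (g-inj eq)) news′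
        (cell-invariant v (g zero) (λ i → news i zero) inv))
    where
    τ₁ = after (hello v (g zero)) σ
    τ₂ = after ack τ₁
    regroup : ∀ a b x y → a + b * x + b * y ≡ a + b * (x + y)
    regroup = solve-∀
    news′ : ∀ i k → w v i ≡ g (suc k) → run (cell v (g zero)) σ i ≡ fresh
    news′ i k wi≡ = trans (cong (λ s → cellStep v (g zero) (ids i) s (heard (hello v (g zero)) σ) (heard ack τ₁) (heard claim τ₂)) (news i (suc k) wi≡))
      (Cell.fresh-stays v (g zero) (heard (hello v (g zero)) σ) (heard ack τ₁) (heard claim τ₂) λ wi≡g0 → contradiction (g-inj (trans (sym wi≡g0) wi≡)) λ ())

  -- After all `M` cells the credit exceeds the elapsed time, which excludes a jam and an empty
  -- queue. So exactly one device is on duty at `close`, and it transmits alone.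
  phase-good : ∀ v {σ} → AllFresh σ → M < c * sum (single ∘ load v) → Won (run (phase v) σ)
  phase-good v {σ} allFresh M<cU rewrite run-++ (cells v id) (close ∷ []) σ
    with cells-invariant {time = 0} v id id (λ i _ _ → allFresh i) (jammed start z≤n)
    where
    -- The phase begins as a jam without holders.
    start : Jammed σ
    start = record
      { solo = λ i → subst Solo (sym (allFresh i)) fresh
      ; twin = λ i cov → ⊥-elim (subst (λ s → Covers s _) (allFresh i) cov)
      }
  ... | jammed _ cU≤M           = contradiction cU≤M (<⇒≱ M<cU)
  ... | proper zero _ cU≤M      = contradiction (≤-trans cU≤M (≤-reflexive (+-identityʳ M))) (<⇒≱ M<cU)
  ... | proper (suc e) P _ with Proper.covered P 0 z<s
  ...   | i , cov = alone⇒won {run (cells v id) σ} (close-sends (ids i) (Proper.queued P i) cov ,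
            λ j j≢i → close-silent (ids j) (Proper.queued P j) λ covj → j≢i (Proper.unique P j i covj cov))

  phases-good : ∀ {vs σ} → AllFresh σ → Any (λ v → M < c * sum (single ∘ load v)) vs → Won (run (phases vs) σ)
  phases-good {v ∷ vs} {σ} allFresh (here good) rewrite run-++ (phase v) (phases vs) σ = won-run (phases vs) (phase-good v allFresh good)
  phases-good {v ∷ vs} {σ} allFresh (there good) rewrite run-++ (phase v) (phases vs) σ with phase-fresh v allFresh
  ... | inj₁ allFresh′ = phases-good allFresh′ good
  ... | inj₂ won       = won-run (phases vs) won

  expense : List (Round M N) → Conf → Fin n → ℕ
  expense []       σ i = 0
  expense (r ∷ rs) σ i = cost (move r (ids i) (σ i)) + expense rs (after r σ) i

  expense-++ : ∀ xs ys σ i → expense (xs ++ ys) σ i ≡ expense xs σ i + expense ys (run xs σ) i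
  expense-++ []       ys σ i = refl
  expense-++ (x ∷ xs) ys σ i = trans (cong (cost (move x (ids i) (σ i)) +_) (expense-++ xs ys (after x σ) i)) (sym (+-assoc (cost (move x (ids i) (σ i))) _ _))

  cells-expense : ∀ {m} v (g : Fin m → Fin M) σ i → expense (cells v g) σ i + reserve (run (cells v g) σ i) ≤ reserve (σ i)
  cells-expense {zero}  v g σ i = ≤-refl
  cells-expense {suc m} v g σ i =
    paid {cost (move (hello v (g zero)) (ids i) (σ i))} (paid {cost (move ack (ids i) (τ₁ i))} (paid {cost (move claim (ids i) (τ₂ i))} (cells-expense v (g ∘ suc) _ i) (claim-cost (ids i) (τ₂ i) _)) (ack-cost (ids i) (τ₁ i) _)) (hello-cost (ids i) (σ i) _)
    where
    τ₁ = after (hello v (g zero)) σ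
    τ₂ = after ack τ₁
    paid : ∀ {k x y a b} → x + y ≤ a → k + a ≤ b → (k + x) + y ≤ b
    paid {k} {x} {y} x+y≤a k+a≤b = ≤-trans (≤-reflexive (+-assoc k x y)) (≤-trans (+-monoʳ-≤ k x+y≤a) k+a≤b)

  -- A phase costs at most the `reserve` of a fresh device, `3 + 3 * c`, plus one round for `close`,
  -- however many cells there are.
  phases-expense : ∀ vs σ i → reserve (σ i) ≤ reserve fresh → expense (phases vs) σ i ≤ length vs * (4 + 3 * c)
  phases-expense []       σ i _ = z≤n
  phases-expense (v ∷ vs) σ i σi≤ rewrite expense-++ (phase v) (phases vs) σ i
    | expense-++ (cells v id) (close ∷ []) σ i | run-++ (cells v id) (close ∷ []) σ = begin
      expense (cells v id) σ i + (cost (move close (ids i) (τ i)) + 0) + expense (phases vs) (after close τ) i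
        ≤⟨ +-mono-≤ (+-mono-≤ (≤-trans (m+n≤o⇒m≤o (expense (cells v id) σ i) (cells-expense v id σ i)) σi≤) (≤-trans (≤-reflexive (+-identityʳ (cost (move close (ids i) (τ i))))) (cost≤1 (move close (ids i) (τ i)))))
             (phases-expense vs (after close τ) i (close-reserve (ids i) (τ i) (heard close τ))) ⟩
      (3 + 3 * c) + 1 + length vs * (4 + 3 * c)   ≡⟨ cong (_+ length vs * (4 + 3 * c)) (+-comm (3 + 3 * c) 1) ⟩
      (4 + 3 * c) + length vs * (4 + 3 * c)       ∎
    where
    open ≤-Reasoning
    τ = run (cells v id) σ

-- The protocol and its execution.

length-cells : ∀ {M N m} (v : Vec (Fin M) N) (g : Fin m → Fin M) → length (cells v g) ≡ m * 3
length-cells {m = zero}  v g = refl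
length-cells {m = suc m} v g = cong (3 +_) (length-cells v (g ∘ suc))

length-phases : ∀ {M N} (vs : List (Vec (Fin M) N)) → length (phases vs) ≡ length vs * (M * 3 + 1)
length-phases []       = refl
length-phases (v ∷ vs) = trans (length-++ (phase v)) (cong₂ _+_ (trans (length-++ (cells v id)) (cong (_+ 1) (length-cells v id))) (length-phases vs))

module Election (c : ℕ) .{{_ : NonZero c}} {M N : ℕ} (vs : List (Vec (Fin M) N)) where

  open Machine c {M} {N}
  open Lifetime c {M} {N}

  rounds : List (Round M N)
  rounds = phases vs ++ final ∷ []

  roundAt : List (Round M N) → ℕ → Round M N
  -- The default is met only after the schedule has ended.
  roundAt []       t       = final
  roundAt (r ∷ rs) zero    = r
  roundAt (r ∷ rs) (suc t) = roundAt rs t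

  role : State → Role
  role lost = false
  role _    = true

  -- The length of the history serves as the clock, so the ID and the history suffice to recompute
  -- the state.
  state : Fin N → History → State
  state i []      = fresh
  state i (f ∷ h) = next (roundAt rounds (length h)) i (state i h) f

  protocol : Protocol N
  protocol = record
    { act    = λ i h → move (roundAt rounds (length h)) i (state i h)
    ; decide = λ i h → if length h <ᵇ length rounds then nothing else just (role (state i h))
    }

  module Run {n} (ids : Fin n → Fin N) where

    open Execution protocol ids
    open Global c {M} ids
    open Phases c {M} ids

    conf : ℕ → Conf
    conf t i = state (ids i) (history t i)

    length-history : ∀ t i → length (history t i) ≡ t
    length-history zero    i = refl
    length-history (suc t) i = cong suc (length-history t i)

    action≡ : ∀ t i → action t i ≡ move (roundAt rounds t) (ids i) (conf t i)
    action≡ t i = cong (λ k → move (roundAt rounds k) (ids i) (conf t i)) (length-history t i)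

    feedback≡ : ∀ t i → feedback t i ≡ perceive (action t i) (channel (transmissions t))
    feedback≡ t i with action t i
    ... | idle       = refl
    ... | listen     = refl
    ... | transmit _ = refl

    energy≡ : ∀ t i → energy (suc t) i ≡ cost (action t i) + energy t i
    energy≡ t i with action t i
    ... | idle       = refl
    ... | listen     = refl
    ... | transmit _ = refl

    transmissions≡ : ∀ t σ → (∀ i → conf t i ≡ σ i) → channel (transmissions t) ≡ heard (roundAt rounds t) σ
    transmissions≡ t σ conf≡ = cong channel (mapMaybe-cong (λ j → cong isTransmit
      (trans (action≡ t j) (cong (move (roundAt rounds t) (ids j)) (conf≡ j)))) (allFin n))

    conf-after : ∀ t σ → (∀ i → conf t i ≡ σ i) → ∀ i → conf (suc t) i ≡ after (roundAt rounds t) σ i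
    conf-after t σ conf≡ i
      rewrite feedback≡ t i | action≡ t i | transmissions≡ t σ conf≡ | length-history t i | conf≡ i = refl

    drop-∷ : ∀ (rs : List (Round M N)) t {r rs′} → drop t rs ≡ r ∷ rs′ → roundAt rs t ≡ r × drop (suc t) rs ≡ rs′
    drop-∷ (r ∷ rs) zero    refl = refl , refl
    drop-∷ (r ∷ rs) (suc t) eq   = drop-∷ rs t eq

    -- Relates rounds counted by `t` to the list recursion of `run` and `expense`; for the
    -- induction, `drop t rounds` keeps track of the schedule still ahead.
    executes : ∀ xs {ys} t σ → drop t rounds ≡ xs ++ ys → (∀ i → conf t i ≡ σ i) →
      (∀ i → conf (length xs + t) i ≡ run xs σ i) × drop (length xs + t) rounds ≡ ys ×
      (∀ i → energy (length xs + t) i ≡ expense xs σ i + energy t i)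
    executes []       t σ at conf≡ = conf≡ , at , λ _ → refl
    executes (x ∷ xs) t σ at conf≡ with drop-∷ rounds t at
    ... | r≡x , at′ with executes xs (suc t) (after x σ) at′ (λ i → trans (conf-after t σ conf≡ i) (cong (λ r → after r σ i) r≡x))
    ...   | conf′ , drop′ , energy′ rewrite +-suc (length xs) t = conf′ , drop′ , λ i → trans (energy′ i) (trans (cong (expense xs (after x σ) i +_) (now i)) (rearrange (expense xs (after x σ) i) (cost (move x (ids i) (σ i))) (energy t i)))
      where
      now : ∀ i → energy (suc t) i ≡ cost (move x (ids i) (σ i)) + energy t i
      now i = trans (energy≡ t i) (cong (λ a → cost a + energy t i) (trans (action≡ t i) (cong₂ (λ r s → move r (ids i) s) r≡x (conf≡ i))))
      rearrange : ∀ a b c → a + (b + c) ≡ b + a + c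
      rearrange = solve-∀

    lastRound : ℕ
    lastRound = length (phases vs)

    length-rounds : length rounds ≡ suc lastRound
    length-rounds = trans (length-++ (phases vs)) (+-comm lastRound 1)

    σ∞ : Conf
    σ∞ = run (phases vs) (λ _ → fresh)

    execution : (∀ i → conf lastRound i ≡ σ∞ i) × roundAt rounds lastRound ≡ final ×
      (∀ i → energy lastRound i ≡ expense (phases vs) (λ _ → fresh) i)
    execution with executes (phases vs) {final ∷ []} 0 (λ _ → fresh) refl (λ _ → refl)
    ... | conf≡ , drop≡ , energy≡ rewrite +-identityʳ (length (phases vs)) =
      conf≡ , proj₁ (drop-∷ rounds _ drop≡) , λ i → trans (energy≡ i) (+-identityʳ _)

    final-action : ∀ i → action lastRound i ≡ move final (ids i) (σ∞ i)
    final-action i = trans (action≡ lastRound i) (cong₂ (λ r s → move r (ids i) s) (proj₁ (proj₂ execution)) (proj₁ execution i))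

    final-conf : ∀ i → conf (suc lastRound) i ≡ σ∞ i
    final-conf i = trans (conf-after lastRound σ∞ (proj₁ execution) i) (cong (λ r → after r σ∞ i) (proj₁ (proj₂ execution)))

    <ᵇ-true : ∀ {m n} → m < n → (m <ᵇ n) ≡ true
    <ᵇ-true {m} {n} m<n with m <ᵇ n | <⇒<ᵇ m<n
    ... | true | _ = refl

    <ᵇ-irrefl : ∀ n → (n <ᵇ n) ≡ false
    <ᵇ-irrefl zero    = refl
    <ᵇ-irrefl (suc n) = <ᵇ-irrefl n

    status≡ : ∀ t i → status t i ≡ (if t <ᵇ suc lastRound then nothing else just (role (conf t i)))
    status≡ t i = cong₂ (λ k l → if k <ᵇ l then nothing else just (role (conf t i))) (length-history t i) length-rounds

    status-running : ∀ s i → s ≤ lastRound → status s i ≡ nothing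
    status-running s i s≤ = trans (status≡ s i) (cong (λ b → if b then nothing else just (role (conf s i))) (<ᵇ-true (s≤s s≤)))

    status-final : ∀ i → status (suc lastRound) i ≡ just (role (σ∞ i))
    status-final i = trans (status≡ (suc lastRound) i)
      (trans (cong (λ b → if b then nothing else just (role (conf (suc lastRound) i))) (<ᵇ-irrefl lastRound)) (cong (just ∘ role) (final-conf i)))

    elects : Won σ∞ → ElectsLeaderAt (suc lastRound)
    elects (ℓ , ℓ≢lost , losers) = status-running , ℓ ,
      trans (status-final ℓ) (cong just (leader (σ∞ ℓ) ℓ≢lost)) ,
      (λ i i≢ℓ → trans (status-final i) (cong (just ∘ role) (losers i i≢ℓ))) ,
      (0 , trans (final-action ℓ) (announce (σ∞ ℓ) ℓ≢lost)) ,
      (λ i i≢ℓ → trans (final-action i) (cong (move final (ids i)) (losers i i≢ℓ)))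
      where
      leader : ∀ s → s ≢ lost → role s ≡ true
      leader lost          s≢ = contradiction refl s≢
      leader fresh         s≢ = refl
      leader asked         s≢ = refl
      leader claiming      s≢ = refl
      leader off           s≢ = refl
      leader (wait j)      s≢ = refl
      leader (hold k e)    s≢ = refl
      leader (guard k e)   s≢ = refl
      leader (serve k e b) s≢ = refl
      announce : ∀ s → s ≢ lost → move final (ids ℓ) s ≡ transmit 0
      announce lost          s≢ = contradiction refl s≢
      announce fresh         s≢ = refl
      announce asked         s≢ = refl
      announce claiming      s≢ = refl
      announce off           s≢ = refl
      announce (wait j)      s≢ = refl
      announce (hold k e)    s≢ = refl
      announce (guard k e)   s≢ = refl
      announce (serve k e b) s≢ = refl

    energy-bound : ∀ i → energy (suc lastRound) i ≤ 1 + length vs * (4 + 3 * c)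
    energy-bound i = begin
      energy (suc lastRound) i                            ≡⟨ energy≡ lastRound i ⟩
      cost (action lastRound i) + energy lastRound i      ≤⟨ +-mono-≤ (cost≤1 (action lastRound i)) (≤-trans (≤-reflexive (proj₂ (proj₂ execution) i)) (phases-expense vs (λ _ → fresh) i ≤-refl)) ⟩
      1 + length vs * (4 + 3 * c)                         ∎
      where open ≤-Reasoning

-- The set of IDs in use.

module Image {n N} (ids : Fin n → Fin N) (ids-injective : Injective _≡_ _≡_ ids) where

  member : Fin N → Bool
  member x = does (any? (λ i → ids i Fin.≟ x))

  indicator : Bool → ℕ
  indicator b = if b then 1 else 0

  image : Vec Bool N
  image = Vec.tabulate member

  -- Since `ids` is injective, at most one summand is nonzero.
  indicator-member : ∀ x → indicator (member x) ≡ sum (λ i → δ (ids i) x)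
  indicator-member x with any? (λ i → ids i Fin.≟ x)
  ... | no unhit = sym (trans (sum-cong-≗ outside) (trans (sum-const n 0) (*-zeroʳ n)))
    where
    outside : ∀ i → δ (ids i) x ≡ 0
    outside i with ids i Fin.≟ x
    ... | yes eq = contradiction (i , eq) unhit
    ... | no  _  = refl
  ... | yes (i , refl) = sym (trans (sum-cong-≗ inside) (sum-δ i (λ _ → 1)))
    where
    inside : ∀ j → δ (ids j) (ids i) ≡ δ i j * 1
    inside j with ids j Fin.≟ ids i | i Fin.≟ j
    ... | yes _  | yes _   = refl
    ... | no _   | no _    = refl
    ... | yes eq | no i≢j  = contradiction (sym (ids-injective eq)) i≢j
    ... | no ≢   | yes i≡j = contradiction (cong ids (sym i≡j)) ≢

  -- A change of variables that turns `size` and `occupancy` of the image into sums over devices.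
  sum-image : (g : Fin N → ℕ) → sum (λ x → indicator (member x) * g x) ≡ sum (g ∘ ids)
  sum-image g = begin
    sum (λ x → indicator (member x) * g x)          ≡⟨ sum-cong-≗ (λ x → trans (cong (_* g x) (indicator-member x)) (*-distribʳ-sum (g x) (λ i → δ (ids i) x))) ⟩
    sum (λ x → sum (λ i → δ (ids i) x * g x))       ≡⟨ ∑-comm (λ x i → δ (ids i) x * g x) ⟩
    sum (λ i → sum (λ x → δ (ids i) x * g x))       ≡⟨ sum-cong-≗ (λ i → sum-δ (ids i) g) ⟩
    sum (g ∘ ids)                                   ∎
    where open ≡-Reasoning

  size-tabulate : ∀ {k} (s : Fin k → Bool) → size (Vec.tabulate s) ≡ sum (λ x → indicator (s x) * 1)
  size-tabulate {zero}  s = refl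
  size-tabulate {suc k} s with s zero
  ... | true  = cong suc (size-tabulate (s ∘ suc))
  ... | false = size-tabulate (s ∘ suc)

  occupancy-tabulate : ∀ {M k} (v : Vec (Fin M) k) (s : Fin k → Bool) q →
    occupancy v (Vec.tabulate s) q ≡ sum (λ x → indicator (s x) * δ (lookup v x) q)
  occupancy-tabulate []      s q = refl
  occupancy-tabulate (x ∷ v) s q with s zero
  ... | true  = cong₂ _+_ (sym (+-identityʳ (δ x q))) (occupancy-tabulate v (s ∘ suc) q)
  ... | false = occupancy-tabulate v (s ∘ suc) q

  size-image : size image ≡ n
  size-image = trans (size-tabulate member) (trans (sum-image (λ _ → 1)) (trans (sum-const n 1) (*-identityʳ n)))

  occupancy-image : ∀ {M} (v : Vec (Fin M) N) q → occupancy v image q ≡ sum (λ i → δ (lookup v (ids i)) q)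
  occupancy-image v q = trans (occupancy-tabulate v member q) (sum-image (λ x → δ (lookup v x) q))

-- Logarithms, constants and the final bounds.

n<2^1+⌊log₂n⌋ : ∀ n → n < 2 ^ suc ⌊log₂ n ⌋
n<2^1+⌊log₂n⌋ n = ≰⇒> λ 2^≤n → <-irrefl refl
  (≤-trans (≤-reflexive (sym (⌊log₂[2^n]⌋≡n (suc ⌊log₂ n ⌋)))) (⌊log₂⌋-mono-≤ 2^≤n))

N≤2^logRatio : ∀ N k → N ≤ 2 ^ suc ⌊log₂ (N / suc k) ⌋ * suc k
N≤2^logRatio N k = begin
  N                                       ≡⟨ m≡m%n+[m/n]*n N (suc k) ⟩
  N % suc k + (N / suc k) * suc k         ≤⟨ +-monoˡ-≤ _ (<⇒≤ (m%n<n N (suc k))) ⟩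
  suc (N / suc k) * suc k                 ≤⟨ *-monoˡ-≤ (suc k) (n<2^1+⌊log₂n⌋ (N / suc k)) ⟩
  2 ^ suc ⌊log₂ (N / suc k) ⌋ * suc k     ∎
  where open ≤-Reasoning

logRatio-anti : ∀ N {m n} → suc m ≤ suc n → logRatio N (suc n) ≤ logRatio N (suc m)
logRatio-anti N m≤n = s≤s (⌊log₂⌋-mono-≤ (/-monoʳ-≤ N m≤n))

-- Abstract, lest Agda evaluate 2 ^ κ.
abstract
  κ : ℕ
  κ = 16

  16≤κ : 16 ≤ κ
  16≤κ = ≤-refl

module Construction (N k : ℕ) where

  ñ : ℕ
  ñ = suc k

  open Hashes κ ñ 16≤κ

  c : ℕ
  c = 4 * Λ

  instance
    c≢0 : NonZero c
    c≢0 = m*n≢0 4 Λ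

  -- More than `ñ / 2` devices, of which fewer than `ñ / 4` share a cell, leave more than `ñ / 4`
  -- alone; `c = 4 * Λ` is chosen so that these contribute more than `M = Λ * ñ` cells of duty.
  enough : ∀ {n u x} → ñ < 2 * n → n ≤ u + 2 * x → 8 * x < ñ → M < c * u
  enough {n} {u} {x} ñ<2n n≤ 8x<ñ = begin-strict
    Λ * ñ           <⟨ *-monoʳ-< Λ ñ<4u ⟩
    Λ * (4 * u)     ≡⟨ assoc Λ u ⟩
    4 * Λ * u       ∎
    where
    open ≤-Reasoning
    assoc : ∀ a b → a * (4 * b) ≡ 4 * a * b
    assoc = solve-∀
    expand : ∀ u x → 4 * (u + 2 * x) ≡ 4 * u + 8 * x
    expand = solve-∀
    double : ∀ n → 2 * (2 * n) ≡ 4 * n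
    double = solve-∀
    ñ<4u : ñ < 4 * u
    ñ<4u = +-cancelʳ-< ñ ñ (4 * u) (begin-strict
      ñ + ñ             ≡⟨ cong (ñ +_) (+-identityʳ ñ) ⟨
      2 * ñ             <⟨ *-monoʳ-< 2 ñ<2n ⟩
      2 * (2 * n)       ≡⟨ double n ⟩
      4 * n             ≤⟨ *-monoʳ-≤ 4 n≤ ⟩
      4 * (u + 2 * x)   ≡⟨ expand u x ⟩
      4 * u + 8 * x     ≤⟨ +-monoʳ-≤ (4 * u) (<⇒≤ 8x<ñ) ⟩
      4 * u + ñ         ∎)

  module _ {n} (ñ<2n : ñ < 2 * n) (n≤ñ : n ≤ ñ) (ids : Fin n → Fin N) (ids-injective : Injective _≡_ _≡_ ids) where

    open Image ids ids-injective
    open Global c {M} ids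
    open Phases c {M} ids

    good⇒M<c*singles : ∀ {v} → Good image v → M < c * sum (single ∘ load v)
    good⇒M<c*singles {v} good = enough {x = excess v image} ñ<2n (begin
      n                                                         ≡⟨ size-image ⟨
      size image                                                ≤⟨ size≤single+excess v image ⟩
      sum (single ∘ occupancy v image) + 2 * excess v image     ≡⟨ cong (_+ 2 * excess v image) (sum-cong-≗ (λ q → cong single (occupancy-image v q))) ⟩
      sum (single ∘ load v) + 2 * excess v image                ∎) good
      where open ≤-Reasoning

    wins : ∀ {vs} → (∀ S → size S ≤ ñ → Any (Good S) vs) → Won (run (phases vs) (λ _ → fresh))
    wins goods = phases-good (λ _ → refl) (Any.map (λ {v} → good⇒M<c*singles {v}) (goods image (≤-trans (≤-reflexive size-image) n≤ñ)))

-- Equal to `1 + 4 * (4 + 3 * c)` with `c = 4 * Λ`, the energy bound for the minimal number of four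
-- phases.
constant : ℕ
constant = 17 + 48 * 2 ^ κ

energy-arithmetic : ∀ {Λ d} L → d ≡ 3 + suc L → 1 + d * (4 + 3 * (4 * Λ)) ≤ (17 + 48 * Λ) * suc L
energy-arithmetic {Λ} L refl = begin
  -- The summand added is the difference of the two sides, so the rest is a polynomial identity.
  1 + (4 + L) * (4 + 3 * (4 * Λ))                       ≤⟨ m≤m+n _ (L * (13 + 36 * Λ)) ⟩
  1 + (4 + L) * (4 + 3 * (4 * Λ)) + L * (13 + 36 * Λ)   ≡⟨ expand Λ L ⟩
  (17 + 48 * Λ) * suc L                                 ∎
  where
  open ≤-Reasoning
  expand : ∀ Λ L → 1 + (4 + L) * (4 + 3 * (4 * Λ)) + L * (13 + 36 * Λ) ≡ (17 + 48 * Λ) * (1 + L)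
  expand = solve-∀

time-arithmetic : ∀ {Λ ñ n d} L → ñ ≤ 2 * n → 1 ≤ n → d ≡ 3 + suc L →
  suc (d * (Λ * ñ * 3 + 1)) ≤ (17 + 48 * Λ) * (n * suc L)
time-arithmetic {Λ} {ñ} {suc n} L ñ≤2n (s≤s z≤n) refl = begin
  suc ((4 + L) * (Λ * ñ * 3 + 1))                ≤⟨ s≤s (*-monoʳ-≤ (4 + L) (+-monoˡ-≤ 1 (*-monoˡ-≤ 3 (*-monoʳ-≤ Λ ñ≤2n)))) ⟩
  suc ((4 + L) * (Λ * (2 * suc n) * 3 + 1))      ≤⟨ m≤m+n _ _ ⟩
  suc ((4 + L) * (Λ * (2 * suc n) * 3 + 1)) + (12 + 16 * L + 17 * n * (1 + L) + 6 * Λ * (1 + n) * (4 + 7 * L))   ≡⟨ expand Λ n L ⟩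
  (17 + 48 * Λ) * (suc n * suc L)                ∎
  where
  open ≤-Reasoning
  expand : ∀ Λ n L → 1 + ((4 + L) * (Λ * (2 * (1 + n)) * 3 + 1)) + (12 + 16 * L + 17 * n * (1 + L) + 6 * Λ * (1 + n) * (4 + 7 * L))
    ≡ (17 + 48 * Λ) * ((1 + n) * (1 + L))
  expand = solve-∀

solution : ∀ N ñ → Σ (Protocol N) (SolvesLE constant N ñ)
-- No `n` has `0 < 2 * n` and `n ≤ 0`, so any protocol will do.
solution N zero = record { act = λ _ _ → idle ; decide = λ _ _ → nothing } , vacuous
  where
  vacuous : ∀ {P : Protocol N} → SolvesLE constant N 0 P
  vacuous zero () n≤0
  vacuous (suc n) 0<2n ()
solution N (suc k) = solve (hashes-exist N ⌊log₂ (N / suc k) ⌋ (N≤2^logRatio N k))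
  where
  open Construction N k
  open Hashes κ (suc k) 16≤κ
  L = ⌊log₂ (N / suc k) ⌋
  solve : (∃ λ (vs : List (Vec (Fin M) N)) → length vs ≡ 4 + L × (∀ S → size S ≤ suc k → Any (Good S) vs)) →
    Σ (Protocol N) (SolvesLE constant N (suc k))
  solve (vs , len , goods) = protocol , solves
    where
    open Election c vs
    solves : SolvesLE constant N (suc k) protocol
    solves zero ()
    solves n@(suc _) ñ<2n n≤ñ ids ids-injective =
      suc lastRound , elects (wins ñ<2n n≤ñ ids ids-injective {vs} goods) , time-bound ,
      λ i → ≤-trans (energy-bound i) (≤-trans (energy-arithmetic {2 ^ κ} L len) (*-monoʳ-≤ constant ratio))
      where
      open Run ids
      open ≤-Reasoning
      -- The protocol is built for `ñ ≥ n`, and `logRatio` does not increase with the number of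
      -- devices.
      ratio : logRatio N (suc k) ≤ logRatio N n
      ratio = logRatio-anti N n≤ñ
      time-bound : suc lastRound ≤ constant * (n * logRatio N n)
      time-bound = begin
        suc (length (phases vs))                  ≡⟨ cong suc (length-phases vs) ⟩
        suc (length vs * (2 ^ κ * suc k * 3 + 1)) ≤⟨ time-arithmetic {2 ^ κ} {suc k} L (<⇒≤ ñ<2n) (s≤s z≤n) len ⟩
        constant * (n * logRatio N (suc k))       ≤⟨ *-monoʳ-≤ constant (*-monoʳ-≤ n ratio) ⟩
        constant * (n * logRatio N n)             ∎

theorem1p3 : Σ ℕ λ c → (N ñ : ℕ) → Σ (Protocol N) λ P → SolvesLE c N ñ P
theorem1p3 = constant , solution
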